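{- Let $m\geq 1$ and $r\geq 1$ be integers. In each sum below $\theta=(\theta_1,\theta_2,\ldots,\theta_p)$ and $p$ is the number of parts of $\theta$. (1) For every integer $q\geq 1$, $$S_{r^m,\bar{q}}=-\sum_{\theta\in\mathcal{C}_m}\binom{m}{\theta_1,\theta_2,\ldots,\theta_p}\big\{\zeta(\bar{q},r\theta_1,r\theta_2,\ldots,r\theta_p)+\zeta(\overline{q+r\theta_1},r\theta_2,\ldots,r\theta_p)\big\}.$$ (2) For every integer $q\geq 2$, $$S_{\bar{r}^m,q}=(-1)^m\sum_{\theta\in\mathcal{C}_m}\binom{m}{\theta_1,\ldots,\theta_p}\Big\{\zeta\big(q,r\theta_1,\ldots,r\theta_p;1,(-1)^{\theta_1},\ldots,(-1)^{\theta_p}\big)+\zeta\big(q+r\theta_1,r\theta_2,\ldots,r\theta_p;(-1)^{\theta_1},(-1)^{\theta_2},\ldots,(-1)^{\theta_p}\big)\Big\}.$$ (3) For every integer $q\geq 1$, $$S_{\bar{r}^m,\bar{q}}=(-1)^{m+1}\sum_{\theta\in\mathcal{C}_m}\binom{m}{\theta_1,\ldots,\theta_p}\Big\{\zeta\big(q,r\theta_1,\ldots,r\theta_p;-1,(-1)^{\theta_1},\ldots,(-1)^{\theta_p}\big)+\zeta\big(q+r\theta_1,r\theta_2,\ldots,r\theta_p;(-1)^{\theta_1+1},(-1)^{\theta_2},\ldots,(-1)^{\theta_p}\big)\Big\}.$$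
   Context: Harmonic numbers and alternating harmonic numbers: $H_n^{(r)}=\sum_{k=1}^n\frac{1}{k^r}$ and $\bar{H}_n^{(r)}=\sum_{k=1}^n\frac{(-1)^{k-1}}{k^r}$ for positive integers $n,r$. Alternating Euler sums: $$S_{r^m,\bar q}=\sum_{n=1}^\infty(-1)^{n-1}\frac{(H_n^{(r)})^m}{n^q},\quad S_{\bar r^m,q}=\sum_{n=1}^\infty\frac{(\bar H_n^{(r)})^m}{n^q},\quad S_{\bar r^m,\bar q}=\sum_{n=1}^\infty(-1)^{n-1}\frac{(\bar H_n^{(r)})^m}{n^q},$$ infinite sums being limits of partial sums. Alternating multiple zeta values: for positive integers $s_j$ and signs $\sigma_j=\pm1$ with $(s_1,\sigma_1)\neq(1,1)$, $$\zeta(s_1,\ldots,s_k;\sigma_1,\ldots,\sigma_k)=\lim_{n\to\infty}\sum_{n\geq n_1>n_2>\cdots>n_k\geq 1}\frac{\sigma_1^{n_1}\cdots\sigma_k^{n_k}}{n_1^{s_1}\cdots n_k^{s_k}}.$$ In the one-string notation (no semicolon), $s_j$ is written in the $j$th position when $\sigma_j=+1$ and $\bar{s}_j$ (or $\overline{s_j}$) when $\sigma_j=-1$; e.g. $\zeta(\bar{s}_1,s_2)=\zeta(s_1,s_2;-1,1)$. A composition of $m$ is an ordered tuple of positive integers summing to $m$, and $\mathcal{C}_m$ is the set of all compositions of $m$. Multinomial coefficients: $\binom{m}{\theta_1,\ldots,\theta_p}=\frac{m!}{\theta_1!\cdots\theta_p!}$. -}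

module Defs where

import Data.Integer.Base as ℤ
import Data.Integer.Properties as ℤ
open import Data.List.Base using (List; []; _∷_; _++_; map; foldr)
open import Data.List.Membership.Propositional using (_∈_)
open import Data.List.Membership.Propositional.Properties using (∈-++⁻; ∈-++⁺ˡ; ∈-++⁺ʳ; ∈-map⁻; ∈-map⁺)
open import Data.List.NonEmpty.Base using (List⁺; _∷_; _∷⁺_; head; tail; toList)
open import Data.List.Relation.Unary.Any using (here; there)
open import Data.List.Relation.Unary.All using (All; []; _∷_)
open import Data.List.Relation.Unary.Unique.Propositional using (Unique)
import Data.List.Relation.Unary.AllPairs as AllPairs
import Data.List.Relation.Unary.Unique.Propositional.Properties as Unique
open import Data.Nat.Base as ℕ using (ℕ; zero; suc; z≤n; s≤s; _!)
open import Data.Nat.ListAction using (sum; product)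
open import Data.Nat.ListAction.Properties using (product≢0)
import Data.Nat.Properties as ℕ
open import Data.Product.Base using (_×_; _,_; ∃; proj₁; proj₂)
open import Data.Rational.Base as ℚ using (ℚ; mkℚ; 0ℚ; 1ℚ; ½; _+_; _*_; -_; _-_; _≤_; _<_; ∣_∣; _/_; *≤*)
open import Data.Rational.Properties
import Data.Rational.Unnormalised.Base as ℚᵘ
import Data.Rational.Unnormalised.Properties as ℚᵘ
open import Data.Rational.Solver using (module +-*-Solver)
open import Data.Sign.Base as Sign using (Sign)
open import Data.Sum.Base using (inj₁; inj₂)
open import Data.Empty using (⊥-elim)
open import Algebra.Definitions.RawSemiring ℚ.+-*-rawSemiring using (_^_)
open import Relation.Nullary using (¬_; yes; no)
open import Relation.Binary.PropositionalEquality
  using (_≡_; refl; sym; trans; cong; cong₂; subst; subst₂; module ≡-Reasoning)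

infix 9 1+_
record ℕ⁺ : Set where
  constructor 1+_
  field pred : ℕ

toℕ : ℕ⁺ → ℕ
toℕ (1+ n) = suc n

infixl 6 _+⁺_
infixl 7 _*⁺_

_+⁺_ _*⁺_ : ℕ⁺ → ℕ⁺ → ℕ⁺
(1+ a) +⁺ (1+ b) = 1+ (a ℕ.+ suc b)
(1+ a) *⁺ (1+ b) = 1+ (b ℕ.+ a ℕ.* suc b)

toℕ-+⁺ : ∀ a b → toℕ (a +⁺ b) ≡ toℕ a ℕ.+ toℕ b
toℕ-+⁺ _ _ = refl

toℕ-*⁺ : ∀ a b → toℕ (a *⁺ b) ≡ toℕ a ℕ.* toℕ b
toℕ-*⁺ _ _ = refl

-- A real number is a Cauchy sequence of rationals: `lim x c` is the limit of
-- the rational sequence x.  An infinite series is `lim` of its partial sums,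
-- so it needs a proof that it converges.

Cauchy : (ℕ → ℚ) → Set
Cauchy x = ∀ ε → 0ℚ < ε → ∃ λ N → ∀ j k → N ℕ.≤ j → N ℕ.≤ k → ∣ x j - x k ∣ < ε

record ℝ : Set where
  constructor lim
  field
    approx : ℕ → ℚ
    cauchy : Cauchy approx
open ℝ public

-- Two limits are equal when the difference of the sequences tends to 0.
infix 4 _≃_
_≃_ : ℝ → ℝ → Set
x ≃ y = ∀ ε → 0ℚ < ε → ∃ λ N → ∀ k → N ℕ.≤ k → ∣ approx x k - approx y k ∣ < ε

module Arithmetic where
  open ≤-Reasoning
  open +-*-Solver using (solve; con; _:=_; _:+_; _:*_; _:-_; :-_)

  half-pos : ∀ {ε} → 0ℚ < ε → 0ℚ < ½ * ε
  half-pos {ε} 0<ε = subst (_< ½ * ε) (*-zeroʳ ½) (*-monoʳ-<-pos ½ 0<ε)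

  half+half : ∀ ε → ½ * ε + ½ * ε ≡ ε
  half+half = solve 1 (λ e → con ½ :* e :+ con ½ :* e := e) refl

  +-cauchy : ∀ {x y} → Cauchy x → Cauchy y → Cauchy (λ n → x n + y n)
  +-cauchy {x} {y} cx cy ε 0<ε with cx (½ * ε) (half-pos 0<ε) | cy (½ * ε) (half-pos 0<ε)
  ... | M , p | N , q = M ℕ.⊔ N , λ j k j≥ k≥ → begin-strict
    ∣ (x j + y j) - (x k + y k) ∣    ≡⟨ cong ∣_∣ (solve 4 (λ a b c d → (a :+ b) :- (c :+ d) := (a :- c) :+ (b :- d)) refl (x j) (y j) (x k) (y k)) ⟩
    ∣ (x j - x k) + (y j - y k) ∣    ≤⟨ ∣p+q∣≤∣p∣+∣q∣ (x j - x k) (y j - y k) ⟩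
    ∣ x j - x k ∣ + ∣ y j - y k ∣    <⟨ +-mono-< (p j k (ℕ.m⊔n≤o⇒m≤o M N j≥) (ℕ.m⊔n≤o⇒m≤o M N k≥))
                                                 (q j k (ℕ.m⊔n≤o⇒n≤o M N j≥) (ℕ.m⊔n≤o⇒n≤o M N k≥)) ⟩
    ½ * ε + ½ * ε                    ≡⟨ half+half ε ⟩
    ε                                ∎

  const-cauchy : ∀ q → Cauchy (λ _ → q)
  const-cauchy q ε 0<ε = 0 , λ _ _ _ _ → subst (λ z → ∣ z ∣ < ε) (sym (+-inverseʳ q)) 0<ε

  *-cauchy : ∀ c {x} → Cauchy x → Cauchy (λ n → c * x n)
  *-cauchy c {x} cx ε 0<ε = N , λ j k j≥ k≥ → begin-strict
      ∣ c * x j - c * x k ∣   ≡⟨ cong ∣_∣ (solve 3 (λ c a b → c :* a :- c :* b := c :* (a :- b)) refl c (x j) (x k)) ⟩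
      ∣ c * (x j - x k) ∣     ≡⟨ ∣p*q∣≡∣p∣*∣q∣ c (x j - x k) ⟩
      ∣ c ∣ * ∣ x j - x k ∣   ≤⟨ *-monoʳ-≤-nonNeg (∣ x j - x k ∣) {{ ∣-∣-nonNeg (x j - x k) }} c≤b ⟩
      b * ∣ x j - x k ∣       <⟨ *-monoʳ-<-pos b (p j k j≥ k≥) ⟩
      b * (ε * 1/b)           ≡⟨ solve 3 (λ b e i → b :* (e :* i) := e :* (b :* i)) refl b ε 1/b ⟩
      ε * (b * 1/b)           ≡⟨ cong (ε *_) (*-inverseʳ b) ⟩
      ε * 1ℚ                  ≡⟨ *-identityʳ ε ⟩
      ε                       ∎
    where
    b = ∣ c ∣ + 1ℚ
    c≤b : ∣ c ∣ ≤ b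
    c≤b = subst (_≤ b) (+-identityʳ ∣ c ∣) (+-monoʳ-≤ ∣ c ∣ (nonNegative⁻¹ 1ℚ))
    instance
      b>0 : ℚ.Positive b
      b>0 = nonNeg+pos⇒pos ∣ c ∣ {{ ∣-∣-nonNeg c }} 1ℚ
      b≢0 : ℚ.NonZero b
      b≢0 = pos⇒nonZero b
    1/b = ℚ.1/ b
    instance
      1/b>0 : ℚ.Positive 1/b
      1/b>0 = 1/pos⇒pos b
    δ>0 : 0ℚ < ε * 1/b
    δ>0 = subst (_< ε * 1/b) (*-zeroˡ 1/b) (*-monoˡ-<-pos 1/b 0<ε)
    N = proj₁ (cx (ε * 1/b) δ>0)
    p = proj₂ (cx (ε * 1/b) δ>0)

  neg-cauchy : ∀ {x} → Cauchy x → Cauchy (λ n → - x n)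
  neg-cauchy {x} cx ε 0<ε with cx ε 0<ε
  ... | N , p = N , λ j k j≥ k≥ → subst (_< ε)
    (trans (sym (∣-p∣≡∣p∣ (x j - x k)))
           (cong ∣_∣ (solve 2 (λ a b → :- (a :- b) := :- a :- :- b) refl (x j) (x k))))
    (p j k j≥ k≥)

infixl 6 _+ℝ_
infix  8 -ℝ_
infixr 7 _•_

0ℝ : ℝ
0ℝ = lim (λ _ → 0ℚ) (Arithmetic.const-cauchy 0ℚ)

_+ℝ_ : ℝ → ℝ → ℝ
lim x cx +ℝ lim y cy = lim (λ n → x n + y n) (Arithmetic.+-cauchy {x} {y} cx cy)

-ℝ_ : ℝ → ℝ
-ℝ lim x cx = lim (λ n → - x n) (Arithmetic.neg-cauchy {x} cx)

_•_ : ℚ → ℝ → ℝ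
c • lim x cx = lim (λ n → c * x n) (Arithmetic.*-cauchy c {x} cx)

infix 5 sumℝ
sumℝ : {A : Set} → List A → (A → ℝ) → ℝ
sumℝ xs f = foldr (λ a s → f a +ℝ s) 0ℝ xs

syntax sumℝ xs (λ a → e) = ∑[ a ∈ xs ] e

infix 5 sum₁
sum₁ : ℕ → (ℕ⁺ → ℚ) → ℚ
sum₁ zero    f = 0ℚ
sum₁ (suc N) f = sum₁ N f + f (1+ N)

syntax sum₁ N (λ n → e) = ∑[1≤ n ≤ N ] e

recip : ℕ⁺ → ℕ⁺ → ℚ
recip n s = _/_ (ℤ.+ 1) (toℕ n ℕ.^ toℕ s) {{ ℕ.m^n≢0 (toℕ n) (toℕ s) }}

alt : ℕ⁺ → ℚ
alt n = (- 1ℚ) ^ (toℕ n ℕ.∸ 1)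

H : (r : ℕ⁺) → ℕ → ℚ
H r n = ∑[1≤ k ≤ n ] recip k r

H̄ : (r : ℕ⁺) → ℕ → ℚ
H̄ r n = ∑[1≤ k ≤ n ] alt k * recip k r

⟦_⟧ : Sign → ℚ
⟦ Sign.+ ⟧ = 1ℚ
⟦ Sign.- ⟧ = - 1ℚ

infixr 8 _^ˢ_
_^ˢ_ : Sign → ℕ → Sign
σ ^ˢ zero  = Sign.+
σ ^ˢ suc n = σ Sign.* σ ^ˢ n

-- One entry (s , σ) of an alternating multiple zeta value; in the
-- one-string notation σ = - is the bar over s.
Entry : Set
Entry = ℕ⁺ × Sign

-- The sum over N ≥ n₁ > n₂ > ⋯ > n_k ≥ 1, as an iterated sum: once n₁ = n
-- is chosen, n₂ ranges up to n - 1.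
ζ-partial : List Entry → ℕ → ℚ
ζ-partial []             N = 1ℚ
ζ-partial ((s , σ) ∷ is) N =
  ∑[1≤ n ≤ N ] ⟦ σ ⟧ ^ toℕ n * recip n s * ζ-partial is (toℕ n ℕ.∸ 1)

Admissible : Entry → Set
Admissible (s , σ) = ¬ (toℕ s ≡ 1 × σ ≡ Sign.+)

bar-admissible : ∀ {s} → Admissible (s , Sign.-)
bar-admissible (_ , ())

≥2-admissible : ∀ {s σ} → 2 ℕ.≤ toℕ s → Admissible (s , σ)
≥2-admissible {1+ zero}    (s≤s ())
≥2-admissible {1+ (suc _)} _        (() , _)

+⁺-admissible : ∀ a b {σ} → Admissible (a +⁺ b , σ)
+⁺-admissible (1+ a) (1+ b) (e , _) with trans (sym (ℕ.+-suc a b)) (ℕ.suc-injective e)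
... | ()

module Convergence where
  open ≤-Reasoning
  open +-*-Solver using (solve; con; _:=_; _:+_; _:*_; _:-_; :-_)
  import Data.Integer.Solver as ℤ-Solver

  nn : ∀ {p} → 0ℚ ≤ p → ℚ.NonNegative p
  nn = ℚ.nonNegative

  *-mono-≤ : ∀ {a b c d} → 0ℚ ≤ a → a ≤ b → 0ℚ ≤ c → c ≤ d → a * c ≤ b * d
  *-mono-≤ {a} {b} {c} {d} 0≤a a≤b 0≤c c≤d = begin
    a * c  ≤⟨ *-monoʳ-≤-nonNeg c {{ nn 0≤c }} a≤b ⟩
    b * c  ≤⟨ *-monoˡ-≤-nonNeg b {{ nn (≤-trans 0≤a a≤b) }} c≤d ⟩
    b * d  ∎

  0≤* : ∀ {a b} → 0ℚ ≤ a → 0ℚ ≤ b → 0ℚ ≤ a * b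
  0≤* {a} {b} p q = subst (_≤ a * b) (*-zeroˡ b) (*-monoʳ-≤-nonNeg b {{ nn q }} p)

  0≤+ : ∀ {a b} → 0ℚ ≤ a → 0ℚ ≤ b → 0ℚ ≤ a + b
  0≤+ {a} {b} p q = subst (_≤ a + b) (+-identityʳ 0ℚ) (+-mono-≤ p q)

  0≤1 : 0ℚ ≤ 1ℚ
  0≤1 = nonNegative⁻¹ 1ℚ

  a≤a+b : ∀ a {b} → 0ℚ ≤ b → a ≤ a + b
  a≤a+b a {b} p = subst (_≤ a + b) (+-identityʳ a) (+-monoʳ-≤ a p)

  ∣*∣≤ : ∀ {a b c d} → ∣ a ∣ ≤ b → ∣ c ∣ ≤ d → ∣ a * c ∣ ≤ b * d
  ∣*∣≤ {a} {b} {c} {d} p q = subst (_≤ b * d) (sym (∣p*q∣≡∣p∣*∣q∣ a c))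
    (*-mono-≤ (0≤∣p∣ a) p (0≤∣p∣ c) q)

  ∣+∣≤ : ∀ {a b c d} → ∣ a ∣ ≤ b → ∣ c ∣ ≤ d → ∣ a + c ∣ ≤ b + d
  ∣+∣≤ {a} {b} {c} {d} p q = ≤-trans (∣p+q∣≤∣p∣+∣q∣ a c) (+-mono-≤ p q)

  ∣-∣-comm : ∀ a b → ∣ a - b ∣ ≡ ∣ b - a ∣
  ∣-∣-comm a b = trans (sym (∣-p∣≡∣p∣ (a - b)))
    (cong ∣_∣ (solve 2 (λ a b → :- (a :- b) := b :- a) refl a b))

  /-homo-* : ∀ i j a b → (i / suc a) * (j / suc b) ≡ (i ℤ.* j) / (suc a ℕ.* suc b)
  /-homo-* i j a b = toℚᵘ-injective (ℚᵘ.≃-trans (toℚᵘ-homo-* (i / suc a) (j / suc b))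
    (ℚᵘ.≃-trans (ℚᵘ.*-cong (toℚᵘ-fromℚᵘ (ℚᵘ.mkℚᵘ i a)) (toℚᵘ-fromℚᵘ (ℚᵘ.mkℚᵘ j b)))
      (ℚᵘ.≃-sym (toℚᵘ-fromℚᵘ (ℚᵘ.mkℚᵘ i a ℚᵘ.* ℚᵘ.mkℚᵘ j b)))))

  unit-fraction-* : ∀ a b .{{_ : ℕ.NonZero a}} .{{_ : ℕ.NonZero b}} .{{_ : ℕ.NonZero (a ℕ.* b)}} →
                    (ℤ.+ 1) / (a ℕ.* b) ≡ ((ℤ.+ 1) / a) * ((ℤ.+ 1) / b)
  unit-fraction-* (suc a) (suc b) = sym (/-homo-* (ℤ.+ 1) (ℤ.+ 1) a b)

  rc : ℕ → ℚ
  rc k = (ℤ.+ 1) / suc k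

  rc>0 : ∀ k → 0ℚ < rc k
  rc>0 k = positive⁻¹ (rc k) {{ normalize-pos 1 (suc k) }}

  rc≥0 : ∀ k → 0ℚ ≤ rc k
  rc≥0 k = <⇒≤ (rc>0 k)

  rc-step : ∀ k → rc (suc k) + rc k * rc (suc k) ≡ rc k
  rc-step k = toℚᵘ-injective
    (ℚᵘ.≃-trans (toℚᵘ-homo-+ y (x * y))
    (ℚᵘ.≃-trans (ℚᵘ.+-cong y≃ (ℚᵘ.≃-trans (toℚᵘ-homo-* x y) (ℚᵘ.*-cong x≃ y≃)))
    (ℚᵘ.≃-trans (ℚᵘ.*≡* (eq (ℤ.+ suc k))) (ℚᵘ.≃-sym x≃))))
    where
    x = rc k
    y = rc (suc k)
    x≃ = toℚᵘ-fromℚᵘ (ℚᵘ.mkℚᵘ (ℤ.+ 1) k)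
    y≃ = toℚᵘ-fromℚᵘ (ℚᵘ.mkℚᵘ (ℤ.+ 1) (suc k))
    eq : ∀ K → let L = ℤ.+ 1 ℤ.+ K in
         (ℤ.+ 1 ℤ.* (K ℤ.* L) ℤ.+ (ℤ.+ 1) ℤ.* L) ℤ.* K ≡ ℤ.+ 1 ℤ.* (L ℤ.* (K ℤ.* L))
    eq = S.solve 1 (λ K → let 𝟙 = S.con (ℤ.+ 1); L = 𝟙 S.:+ K in
         (𝟙 S.:* (K S.:* L) S.:+ 𝟙 S.:* L) S.:* K S.:= 𝟙 S.:* (L S.:* (K S.:* L))) refl
      where module S = ℤ-Solver.+-*-Solver

  rc-suc≤ : ∀ k → rc (suc k) ≤ rc k
  rc-suc≤ k = subst (rc (suc k) ≤_) (rc-step k) (a≤a+b (rc (suc k)) (0≤* (rc≥0 k) (rc≥0 (suc k))))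

  antitone : ∀ (f : ℕ → ℚ) → (∀ k → f (suc k) ≤ f k) → ∀ {j k} → j ℕ.≤ k → f k ≤ f j
  antitone f step j≤k = go (ℕ.≤⇒≤′ j≤k)
    where
    go : ∀ {j k} → j ℕ.≤′ k → f k ≤ f j
    go ℕ.≤′-refl         = ≤-refl
    go (ℕ.≤′-step j≤′k) = ≤-trans (step _) (go j≤′k)

  rc≤1 : ∀ k → rc k ≤ 1ℚ
  rc≤1 k = antitone rc rc-suc≤ (z≤n {k})

  rc≤2rc : ∀ k → rc k ≤ rc (suc k) + rc (suc k)
  rc≤2rc k = begin
    rc k                           ≡⟨ rc-step k ⟨
    rc (suc k) + rc k * rc (suc k) ≤⟨ +-monoʳ-≤ (rc (suc k)) (*-monoʳ-≤-nonNeg (rc (suc k)) {{ nn (rc≥0 (suc k)) }} (rc≤1 k)) ⟩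
    rc (suc k) + 1ℚ * rc (suc k)   ≡⟨ cong (rc (suc k) +_) (*-identityˡ (rc (suc k))) ⟩
    rc (suc k) + rc (suc k)        ∎

  archimedes : ∀ δ → 0ℚ < δ → ∃ λ N → rc N ≤ δ
  archimedes δ@(mkℚ (ℤ.+ zero) d c) 0<δ = ⊥-elim (<-irrefl (sym (↥p≡0⇒p≡0 δ refl)) 0<δ)
  archimedes δ@(mkℚ ℤ.-[1+ n ] d c) 0<δ = ⊥-elim (<-asym 0<δ (negative⁻¹ δ))
  archimedes δ@(mkℚ (ℤ.+ suc n) d c) _ = d , toℚᵘ-cancel-≤
    (ℚᵘ.≤-respˡ-≃ (ℚᵘ.≃-sym (toℚᵘ-fromℚᵘ (ℚᵘ.mkℚᵘ (ℤ.+ 1) d)))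
      (ℚᵘ.*≤* (ℤ.*-monoʳ-≤-nonNeg (ℤ.+ suc d) (ℤ.+≤+ {1} {suc n} (s≤s z≤n)))))

  recip-suc : ∀ k s → recip (1+ k) (1+ suc s) ≡ rc k * recip (1+ k) (1+ s)
  recip-suc k s = unit-fraction-* (suc k) (suc k ℕ.^ suc s) {{ _ }} {{ ℕ.m^n≢0 (suc k) (suc s) }} {{ ℕ.m^n≢0 (suc k) (suc (suc s)) }}

  recip-1 : ∀ k → recip (1+ k) (1+ 0) ≡ rc k
  recip-1 k = trans (unit-fraction-* (suc k) 1 {{ _ }} {{ _ }} {{ ℕ.m^n≢0 (suc k) 1 }}) (*-identityʳ (rc k))

  recip≥0 : ∀ n s → 0ℚ ≤ recip n s
  recip≥0 n s = nonNegative⁻¹ (recip n s) {{ normalize-nonNeg 1 (toℕ n ℕ.^ toℕ s) {{ ℕ.m^n≢0 (toℕ n) (toℕ s) }} }}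

  recip≤rc : ∀ k s → recip (1+ k) s ≤ rc k
  recip≤rc k (1+ zero)  = ≤-reflexive (recip-1 k)
  recip≤rc k (1+ suc s) = begin
    recip (1+ k) (1+ suc s)      ≡⟨ recip-suc k s ⟩
    rc k * recip (1+ k) (1+ s)   ≤⟨ *-monoˡ-≤-nonNeg (rc k) {{ nn (rc≥0 k) }} (≤-trans (recip≤rc k (1+ s)) (rc≤1 k)) ⟩
    rc k * 1ℚ                    ≡⟨ *-identityʳ (rc k) ⟩
    rc k                         ∎

  recip≤rc² : ∀ k s → recip (1+ k) (1+ suc s) ≤ rc k * rc k
  recip≤rc² k s = subst (_≤ rc k * rc k) (sym (recip-suc k s))
    (*-monoˡ-≤-nonNeg (rc k) {{ nn (rc≥0 k) }} (recip≤rc k (1+ s)))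

  -- w j k grows like a power of k with exponent 3^-j; its increments are
  -- 3^-j w j k / (k + 1), so sums of w j k / (k + 1) telescope.
  ⅓ : ℚ
  ⅓ = (ℤ.+ 1) / 3

  3ℚ : ℚ
  3ℚ = (ℤ.+ 3) / 1

  θ : ℕ → ℚ
  θ zero    = 1ℚ
  θ (suc j) = ⅓ * θ j

  θ≥0 : ∀ j → 0ℚ ≤ θ j
  θ≥0 zero    = 0≤1
  θ≥0 (suc j) = 0≤* (nonNegative⁻¹ ⅓) (θ≥0 j)

  θ≤1 : ∀ j → θ j ≤ 1ℚ
  θ≤1 zero    = ≤-refl
  θ≤1 (suc j) = *-mono-≤ {⅓} {1ℚ} (nonNegative⁻¹ ⅓) (*≤* (ℤ.+≤+ (s≤s z≤n))) (θ≥0 j) (θ≤1 j)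

  1/θ : ℕ → ℚ
  1/θ zero    = 1ℚ
  1/θ (suc j) = 3ℚ * 1/θ j

  1/θ≥0 : ∀ j → 0ℚ ≤ 1/θ j
  1/θ≥0 zero    = 0≤1
  1/θ≥0 (suc j) = 0≤* (nonNegative⁻¹ 3ℚ) (1/θ≥0 j)

  1/θ*θ : ∀ j → 1/θ j * θ j ≡ 1ℚ
  1/θ*θ zero    = refl
  1/θ*θ (suc j) = trans (solve 2 (λ a b → (con 3ℚ :* a) :* (con ⅓ :* b) := a :* b) refl (1/θ j) (θ j)) (1/θ*θ j)

  w : ℕ → ℕ → ℚ
  w j zero    = 1ℚ
  w j (suc k) = w j k * (1ℚ + θ j * rc k)

  θrc≥0 : ∀ j k → 0ℚ ≤ θ j * rc k
  θrc≥0 j k = 0≤* (θ≥0 j) (rc≥0 k)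

  θrc≤1 : ∀ j k → θ j * rc k ≤ 1ℚ
  θrc≤1 j k = *-mono-≤ (θ≥0 j) (θ≤1 j) (rc≥0 k) (rc≤1 k)

  w≥0 : ∀ j k → 0ℚ ≤ w j k
  w≥0 j zero    = 0≤1
  w≥0 j (suc k) = 0≤* (w≥0 j k) (0≤+ 0≤1 (θrc≥0 j k))

  w-suc : ∀ j k → w j (suc k) ≡ w j k + θ j * (w j k * rc k)
  w-suc j k = solve 3 (λ w t x → w :* (con 1ℚ :+ t :* x) := w :+ t :* (w :* x)) refl (w j k) (θ j) (rc k)

  1≤w : ∀ j k → 1ℚ ≤ w j k
  1≤w j zero    = ≤-refl
  1≤w j (suc k) = ≤-trans (1≤w j k) (subst (w j k ≤_) (sym (w-suc j k))
    (a≤a+b (w j k) (0≤* (θ≥0 j) (0≤* (w≥0 j k) (rc≥0 k)))))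

  w-suc≤ : ∀ j k → w j (suc k) ≤ w j k + w j k
  w-suc≤ j k = begin
    w j k * (1ℚ + θ j * rc k)  ≤⟨ *-monoˡ-≤-nonNeg (w j k) {{ nn (w≥0 j k) }} (+-monoʳ-≤ 1ℚ (θrc≤1 j k)) ⟩
    w j k * (1ℚ + 1ℚ)          ≡⟨ solve 1 (λ w → w :* (con 1ℚ :+ con 1ℚ) := w :+ w) refl (w j k) ⟩
    w j k + w j k              ∎

  w² : ∀ j k → w (suc j) k * w (suc j) k ≤ w j k
  w² j zero    = ≤-refl
  w² j (suc k) = begin
    (v * (1ℚ + (⅓ * t) * x)) * (v * (1ℚ + (⅓ * t) * x))
      ≡⟨ solve 3 (λ v t x → (v :* (con 1ℚ :+ (con ⅓ :* t) :* x)) :* (v :* (con 1ℚ :+ (con ⅓ :* t) :* x))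
          := (v :* v) :* (con 1ℚ :+ (con ⅔ :* (t :* x) :+ con ⅑ :* ((t :* x) :* (t :* x))))) refl v t x ⟩
    (v * v) * (1ℚ + (⅔ * y + ⅑ * (y * y)))
      ≤⟨ *-mono-≤ (0≤* (w≥0 (suc j) k) (w≥0 (suc j) k)) (w² j k)
           (0≤+ 0≤1 (0≤+ (0≤* (nonNegative⁻¹ ⅔) y≥0) (0≤* (nonNegative⁻¹ ⅑) (0≤* y≥0 y≥0))))
           (+-monoʳ-≤ 1ℚ (+-monoʳ-≤ (⅔ * y) step)) ⟩
    w j k * (1ℚ + (⅔ * y + ⅓ * (y * 1ℚ)))
      ≡⟨ solve 2 (λ w y → w :* (con 1ℚ :+ (con ⅔ :* y :+ con ⅓ :* (y :* con 1ℚ))) := w :* (con 1ℚ :+ y)) refl (w j k) y ⟩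
    w j k * (1ℚ + y)  ∎
    where
    v = w (suc j) k
    t = θ j
    x = rc k
    y = t * x
    ⅔ = (ℤ.+ 2) / 3
    ⅑ = (ℤ.+ 1) / 9
    y≥0 = θrc≥0 j k
    step : ⅑ * (y * y) ≤ ⅓ * (y * 1ℚ)
    step = *-mono-≤ {⅑} {⅓} (nonNegative⁻¹ ⅑) (*≤* (ℤ.+≤+ (s≤s (s≤s (s≤s z≤n))))) (0≤* y≥0 y≥0)
             (*-monoˡ-≤-nonNeg y {{ nn y≥0 }} (θrc≤1 j k))

  w₀*rc : ∀ k → w 0 k * rc k ≡ 1ℚ
  w₀*rc zero    = refl
  w₀*rc (suc k) = trans (solve 3 (λ w x y → (w :* (con 1ℚ :+ con 1ℚ :* x)) :* y := w :* (y :+ x :* y)) refl (w 0 k) (rc k) (rc (suc k)))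
    (trans (cong (w 0 k *_) (rc-step k)) (w₀*rc k))

  -- Sequences whose increments are O(k^(e-1)) for every e > 0
  Slow : (ℕ → ℚ) → Set
  Slow a = ∀ j → ∃ λ C → 0ℚ ≤ C × (∀ k → ∣ a (suc k) - a k ∣ ≤ C * (w j k * rc k))

  slow-bounded : ∀ a → Slow a → ∀ j → ∃ λ D → 0ℚ ≤ D × (∀ k → ∣ a k ∣ ≤ D * w j k)
  slow-bounded a sl j with sl j
  ... | C , C≥0 , p = D , D≥0 , go
    where
    E = C * 1/θ j
    E≥0 = 0≤* C≥0 (1/θ≥0 j)
    D = ∣ a 0 ∣ + E
    D≥0 = 0≤+ (0≤∣p∣ (a 0)) E≥0
    E≤D : E ≤ D
    E≤D = subst (E ≤_) (+-comm E ∣ a 0 ∣) (a≤a+b E (0≤∣p∣ (a 0)))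
    go : ∀ k → ∣ a k ∣ ≤ D * w j k
    go zero = subst (∣ a 0 ∣ ≤_) (sym (*-identityʳ D)) (a≤a+b ∣ a 0 ∣ E≥0)
    go (suc k) = begin
      ∣ a (suc k) ∣                          ≡⟨ cong ∣_∣ (solve 2 (λ a b → b := a :+ (b :- a)) refl (a k) (a (suc k))) ⟩
      ∣ a k + (a (suc k) - a k) ∣            ≤⟨ ∣+∣≤ {a k} {_} {a (suc k) - a k} (go k) (p k) ⟩
      D * w j k + C * (w j k * rc k)         ≡⟨ cong (λ z → D * w j k + z * (w j k * rc k)) C≡ ⟩
      D * w j k + (E * θ j) * (w j k * rc k) ≤⟨ +-monoʳ-≤ (D * w j k) (*-monoʳ-≤-nonNeg (w j k * rc k) {{ nn (0≤* (w≥0 j k) (rc≥0 k)) }}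
                                                 (*-monoʳ-≤-nonNeg (θ j) {{ nn (θ≥0 j) }} E≤D)) ⟩
      D * w j k + (D * θ j) * (w j k * rc k) ≡⟨ solve 4 (λ D w t x → D :* w :+ (D :* t) :* (w :* x) := D :* (w :* (con 1ℚ :+ t :* x))) refl D (w j k) (θ j) (rc k) ⟩
      D * w j (suc k)                        ∎
      where
      C≡ : C ≡ E * θ j
      C≡ = sym (trans (*-assoc C (1/θ j) (θ j)) (trans (cong (C *_) (1/θ*θ j)) (*-identityʳ C)))

  slow-const : ∀ c → Slow (λ _ → c)
  slow-const c j = 0ℚ , ≤-refl , λ k → ≤-reflexive
    (trans (cong ∣_∣ (+-inverseʳ c)) (sym (*-zeroˡ (w j k * rc k))))

  slow-shift : ∀ a → Slow a → Slow (λ k → a (suc k))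
  slow-shift a sl j with sl j
  ... | C , C≥0 , p = C + C , 0≤+ C≥0 C≥0 , λ k → begin
      ∣ a (suc (suc k)) - a (suc k) ∣     ≤⟨ p (suc k) ⟩
      C * (w j (suc k) * rc (suc k))      ≤⟨ *-monoˡ-≤-nonNeg C {{ nn C≥0 }} (*-mono-≤ (w≥0 j (suc k)) (w-suc≤ j k) (rc≥0 (suc k)) (rc-suc≤ k)) ⟩
      C * ((w j k + w j k) * rc k)        ≡⟨ solve 3 (λ C w x → C :* ((w :+ w) :* x) := (C :+ C) :* (w :* x)) refl C (w j k) (rc k) ⟩
      (C + C) * (w j k * rc k)            ∎

  slow-* : ∀ a b → Slow a → Slow b → Slow (λ k → a k * b k)
  slow-* a b sa sb j with sa (suc j) | sb (suc j) | slow-bounded _ (slow-shift a sa) (suc j) | slow-bounded b sb (suc j)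
  ... | C , C≥0 , p | C′ , C′≥0 , p′ | D , D≥0 , q | D′ , D′≥0 , q′ =
    K , K≥0 , λ k → let v = w (suc j) k; x = rc k in begin
      ∣ a (suc k) * b (suc k) - a k * b k ∣
        ≡⟨ cong ∣_∣ (solve 4 (λ a a′ b b′ → a′ :* b′ :- a :* b := a′ :* (b′ :- b) :+ (a′ :- a) :* b) refl (a k) (a (suc k)) (b k) (b (suc k))) ⟩
      ∣ a (suc k) * (b (suc k) - b k) + (a (suc k) - a k) * b k ∣
        ≤⟨ ∣+∣≤ {a (suc k) * (b (suc k) - b k)} {_} {(a (suc k) - a k) * b k}
             (∣*∣≤ {a (suc k)} {_} {b (suc k) - b k} (q k) (p′ k)) (∣*∣≤ {a (suc k) - a k} {_} {b k} (p k) (q′ k)) ⟩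
      (D * v) * (C′ * (v * x)) + (C * (v * x)) * (D′ * v)
        ≡⟨ solve 6 (λ D C C′ D′ v x → (D :* v) :* (C′ :* (v :* x)) :+ (C :* (v :* x)) :* (D′ :* v)
             := (D :* C′ :+ C :* D′) :* ((v :* v) :* x)) refl D C C′ D′ v x ⟩
      K * ((v * v) * x)
        ≤⟨ *-monoˡ-≤-nonNeg K {{ nn K≥0 }} (*-monoʳ-≤-nonNeg x {{ nn (rc≥0 k) }} (w² j k)) ⟩
      K * (w j k * x) ∎
    where
    K = D * C′ + C * D′
    K≥0 = 0≤+ (0≤* D≥0 C′≥0) (0≤* C≥0 D′≥0)

  slow-^ : ∀ a → Slow a → ∀ m → Slow (λ k → a k ^ m)
  slow-^ a sa zero    = slow-const 1ℚ
  slow-^ a sa (suc m) = slow-* a (λ k → a k ^ m) sa (slow-^ a sa m)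

  slow-sum : ∀ (f : ℕ⁺ → ℚ) (b : ℕ → ℚ) → Slow b → (∀ k → ∣ f (1+ k) ∣ ≤ rc k * ∣ b k ∣) → Slow (λ N → sum₁ N f)
  slow-sum f b sb p j with slow-bounded b sb j
  ... | D , D≥0 , q = D , D≥0 , λ k → begin
      ∣ (sum₁ k f + f (1+ k)) - sum₁ k f ∣  ≡⟨ cong ∣_∣ (solve 2 (λ s t → (s :+ t) :- s := t) refl (sum₁ k f) (f (1+ k))) ⟩
      ∣ f (1+ k) ∣                          ≤⟨ p k ⟩
      rc k * ∣ b k ∣                        ≤⟨ *-monoˡ-≤-nonNeg (rc k) {{ nn (rc≥0 k) }} (q k) ⟩
      rc k * (D * w j k)                    ≡⟨ solve 3 (λ x D w → x :* (D :* w) := D :* (w :* x)) refl (rc k) D (w j k) ⟩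
      D * (w j k * rc k)                    ∎

  -- u k = w 1 k / (k + 1) decreases to 0
  u : ℕ → ℚ
  u k = w 1 k * rc k

  u≥0 : ∀ k → 0ℚ ≤ u k
  u≥0 k = 0≤* (w≥0 1 k) (rc≥0 k)

  ⅔ : ℚ
  ⅔ = (ℤ.+ 2) / 3

  u-step : ∀ k → u k ≡ u (suc k) + ⅔ * (w 1 k * (rc k * rc (suc k)))
  u-step k = trans (cong (w 1 k *_) (sym (rc-step k)))
    (solve 3 (λ w x y → w :* (y :+ x :* y)
        := (w :* (con 1ℚ :+ (con ⅓ :* con 1ℚ) :* x)) :* y :+ con ⅔ :* (w :* (x :* y))) refl (w 1 k) (rc k) (rc (suc k)))

  wxy≥0 : ∀ k → 0ℚ ≤ w 1 k * (rc k * rc (suc k))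
  wxy≥0 k = 0≤* (w≥0 1 k) (0≤* (rc≥0 k) (rc≥0 (suc k)))

  u-suc≤ : ∀ k → u (suc k) ≤ u k
  u-suc≤ k = subst (u (suc k) ≤_) (sym (u-step k)) (a≤a+b (u (suc k)) (0≤* (nonNegative⁻¹ ⅔) (wxy≥0 k)))

  3/2 : ℚ
  3/2 = (ℤ.+ 3) / 2

  wxy≡ : ∀ k → w 1 k * (rc k * rc (suc k)) ≡ 3/2 * (u k - u (suc k))
  wxy≡ k = sym (trans (cong (λ z → 3/2 * (z - u (suc k))) (u-step k))
    (solve 2 (λ a b → con 3/2 :* ((a :+ con ⅔ :* b) :- a) := b) refl (u (suc k)) (w 1 k * (rc k * rc (suc k)))))

  u²≤rc : ∀ k → u k * u k ≤ rc k
  u²≤rc k = begin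
    (w 1 k * x) * (w 1 k * x)    ≡⟨ solve 2 (λ w x → (w :* x) :* (w :* x) := (w :* w) :* (x :* x)) refl (w 1 k) x ⟩
    (w 1 k * w 1 k) * (x * x)    ≤⟨ *-monoʳ-≤-nonNeg (x * x) {{ nn (0≤* (rc≥0 k) (rc≥0 k)) }} (w² 0 k) ⟩
    w 0 k * (x * x)              ≡⟨ *-assoc (w 0 k) x x ⟨
    (w 0 k * x) * x              ≡⟨ cong (_* x) (w₀*rc k) ⟩
    1ℚ * x                       ≡⟨ *-identityˡ x ⟩
    x                            ∎
    where x = rc k

  u-null : ∀ B → 0ℚ < B → ∀ ε → 0ℚ < ε → ∃ λ N → B * u N < ε
  u-null B 0<B ε 0<ε with archimedes δ δ>0
    where
    instance
      B>0 : ℚ.Positive B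
      B>0 = ℚ.positive 0<B
      B≢0 : ℚ.NonZero B
      B≢0 = pos⇒nonZero B
      1/B>0 : ℚ.Positive (ℚ.1/ B)
      1/B>0 = 1/pos⇒pos B
      h>0 : ℚ.Positive (½ * ε * ℚ.1/ B)
      h>0 = pos*pos⇒pos (½ * ε) {{ ℚ.positive (Arithmetic.half-pos 0<ε) }} (ℚ.1/ B)
    δ = (½ * ε * ℚ.1/ B) * (½ * ε * ℚ.1/ B)
    δ>0 : 0ℚ < δ
    δ>0 = positive⁻¹ δ {{ pos*pos⇒pos (½ * ε * ℚ.1/ B) (½ * ε * ℚ.1/ B) }}
  ... | N , rcN≤δ with B * u N <? ε
  ... | yes lt = N , lt
  ... | no  ≮  = ⊥-elim (<-irrefl refl (begin-strict
      ε * ε                  ≤⟨ *-mono-≤ (<⇒≤ 0<ε) (≮⇒≥ ≮) (<⇒≤ 0<ε) (≮⇒≥ ≮) ⟩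
      (B * u N) * (B * u N)  ≡⟨ solve 2 (λ B u → (B :* u) :* (B :* u) := (B :* B) :* (u :* u)) refl B (u N) ⟩
      (B * B) * (u N * u N)  ≤⟨ *-monoˡ-≤-nonNeg (B * B) {{ nn (0≤* (<⇒≤ 0<B) (<⇒≤ 0<B)) }} (≤-trans (u²≤rc N) rcN≤δ) ⟩
      (B * B) * (h * h)      ≡⟨ solve 3 (λ B e i → (B :* B) :* ((con ½ :* e :* i) :* (con ½ :* e :* i)) := (con ½ :* e :* (B :* i)) :* (con ½ :* e :* (B :* i))) refl B ε (ℚ.1/ B) ⟩
      (½ * ε * (B * ℚ.1/ B)) * (½ * ε * (B * ℚ.1/ B)) ≡⟨ cong (λ z → (½ * ε * z) * (½ * ε * z)) (*-inverseʳ B) ⟩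
      (½ * ε * 1ℚ) * (½ * ε * 1ℚ)  ≡⟨ cong (λ z → z * z) (*-identityʳ (½ * ε)) ⟩
      (½ * ε) * (½ * ε)      ≤⟨ *-monoˡ-≤-nonNeg (½ * ε) {{ nn (<⇒≤ h>0) }} (<⇒≤ h<) ⟩
      (½ * ε) * ε            <⟨ *-monoˡ-<-pos ε {{ ℚ.positive 0<ε }} h< ⟩
      ε * ε                  ∎))
    where
    instance
      B≢0 : ℚ.NonZero B
      B≢0 = pos⇒nonZero B {{ ℚ.positive 0<B }}
    h = ½ * ε * ℚ.1/ B
    h>0 = Arithmetic.half-pos 0<ε
    h< : ½ * ε < ε
    h< = subst₂ _<_ (+-identityʳ (½ * ε)) (Arithmetic.half+half ε) (+-monoʳ-< (½ * ε) h>0)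

  -- If T stays within O(u) of V and the increments of V are dominated by
  -- those of u, then T is Cauchy.
  dominated : ∀ (T V : ℕ → ℚ) K D → 0ℚ ≤ K → 0ℚ ≤ D →
              (∀ k → ∣ T k - V k ∣ ≤ D * u k) →
              (∀ k → ∣ V (suc k) - V k ∣ ≤ K * (u k - u (suc k))) →
              Cauchy T
  dominated T V K D K≥0 D≥0 near step ε 0<ε = N , cauchy′
    where
    V-bound : ∀ {j k} → j ℕ.≤′ k → ∣ V k - V j ∣ ≤ K * (u j - u k)
    V-bound {j} ℕ.≤′-refl = ≤-reflexive (trans (cong ∣_∣ (+-inverseʳ (V j)))
      (solve 2 (λ K u → con 0ℚ := K :* (u :- u)) refl K (u j)))
    V-bound {j} (ℕ.≤′-step {k} j≤k) = begin
      ∣ V (suc k) - V j ∣                        ≡⟨ cong ∣_∣ (solve 3 (λ a b c → c :- a := (c :- b) :+ (b :- a)) refl (V j) (V k) (V (suc k))) ⟩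
      ∣ (V (suc k) - V k) + (V k - V j) ∣        ≤⟨ ∣+∣≤ {V (suc k) - V k} {_} {V k - V j} (step k) (V-bound j≤k) ⟩
      K * (u k - u (suc k)) + K * (u j - u k)    ≡⟨ solve 4 (λ K a b c → K :* (b :- c) :+ K :* (a :- b) := K :* (a :- c)) refl K (u j) (u k) (u (suc k)) ⟩
      K * (u j - u (suc k))                      ∎
    V-bound′ : ∀ {j k} → j ℕ.≤ k → ∣ V k - V j ∣ ≤ K * u j
    V-bound′ {j} {k} j≤k = ≤-trans (V-bound (ℕ.≤⇒≤′ j≤k)) (*-monoˡ-≤-nonNeg K {{ nn K≥0 }}
      (subst (u j - u k ≤_) (+-identityʳ (u j)) (+-monoʳ-≤ (u j) (neg-antimono-≤ (u≥0 k)))))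
    B = D + K
    B≥0 = 0≤+ D≥0 K≥0
    T-bound : ∀ {j k} → j ℕ.≤ k → ∣ T k - V j ∣ ≤ B * u j
    T-bound {j} {k} j≤k = begin
      ∣ T k - V j ∣                  ≡⟨ cong ∣_∣ (solve 3 (λ t v v′ → t :- v′ := (t :- v) :+ (v :- v′)) refl (T k) (V k) (V j)) ⟩
      ∣ (T k - V k) + (V k - V j) ∣  ≤⟨ ∣+∣≤ {T k - V k} {_} {V k - V j} (≤-trans (near k)
                                         (*-monoˡ-≤-nonNeg D {{ nn D≥0 }} (antitone u u-suc≤ j≤k))) (V-bound′ j≤k) ⟩
      D * u j + K * u j              ≡⟨ *-distribʳ-+ (u j) D K ⟨
      B * u j                        ∎
    B₁ = (B + B) + 1ℚ
    0<B₁ : 0ℚ < B₁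
    0<B₁ = subst (_< B₁) (+-identityʳ 0ℚ) (+-mono-≤-< (0≤+ B≥0 B≥0) (positive⁻¹ 1ℚ))
    null = u-null B₁ 0<B₁ ε 0<ε
    N = proj₁ null
    cauchy′ : ∀ j k → N ℕ.≤ j → N ℕ.≤ k → ∣ T j - T k ∣ < ε
    cauchy′ j k N≤j N≤k = begin-strict
      ∣ T j - T k ∣                  ≡⟨ cong ∣_∣ (solve 3 (λ a b v → a :- b := (a :- v) :+ (v :- b)) refl (T j) (T k) (V N)) ⟩
      ∣ (T j - V N) + (V N - T k) ∣  ≤⟨ ∣+∣≤ {T j - V N} {_} {V N - T k} (T-bound N≤j)
                                         (subst (_≤ B * u N) (∣-∣-comm (T k) (V N)) (T-bound N≤k)) ⟩
      B * u N + B * u N              ≡⟨ *-distribʳ-+ (u N) B B ⟨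
      (B + B) * u N                  ≤⟨ *-monoʳ-≤-nonNeg (u N) {{ nn (u≥0 N) }} (a≤a+b (B + B) 0≤1) ⟩
      B₁ * u N                       <⟨ proj₂ null ⟩
      ε                              ∎

  absolute : ∀ (f : ℕ⁺ → ℚ) (b : ℕ → ℚ) → Slow b →
             (∀ k → ∣ f (1+ k) ∣ ≤ (rc k * rc k) * ∣ b k ∣) → Cauchy (λ N → sum₁ N f)
  absolute f b sb p with slow-bounded b sb 1
  ... | D , D≥0 , q = dominated T T K 0ℚ K≥0 ≤-refl
        (λ k → ≤-reflexive (trans (cong ∣_∣ (+-inverseʳ (T k))) (sym (*-zeroˡ (u k))))) step
    where
    T : ℕ → ℚ
    T N = sum₁ N f
    K = (D + D) * 3/2
    K≥0 = 0≤* (0≤+ D≥0 D≥0) (nonNegative⁻¹ 3/2)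
    step : ∀ k → ∣ T (suc k) - T k ∣ ≤ K * (u k - u (suc k))
    step k = begin
      ∣ (T k + f (1+ k)) - T k ∣      ≡⟨ cong ∣_∣ (solve 2 (λ s t → (s :+ t) :- s := t) refl (T k) (f (1+ k))) ⟩
      ∣ f (1+ k) ∣                    ≤⟨ p k ⟩
      (x * x) * ∣ b k ∣               ≤⟨ *-mono-≤ (0≤* x≥0 x≥0) (*-monoˡ-≤-nonNeg x {{ nn x≥0 }} (rc≤2rc k)) (0≤∣p∣ (b k)) (q k) ⟩
      (x * (y + y)) * (D * w 1 k)     ≡⟨ solve 4 (λ x y D w → (x :* (y :+ y)) :* (D :* w) := (D :+ D) :* (w :* (x :* y))) refl x y D (w 1 k) ⟩
      (D + D) * (w 1 k * (x * y))     ≡⟨ cong ((D + D) *_) (wxy≡ k) ⟩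
      (D + D) * (3/2 * (u k - u (suc k)))  ≡⟨ *-assoc (D + D) 3/2 (u k - u (suc k)) ⟨
      K * (u k - u (suc k))           ∎
      where
      x = rc k
      y = rc (suc k)
      x≥0 = rc≥0 k

  -- Summation by parts against coefficients e with bounded partial sums E
  by-parts : ∀ (f : ℕ⁺ → ℚ) (e E b : ℕ → ℚ) → Slow b →
             (∀ k → f (1+ k) ≡ e k * rc k * b k) →
             (∀ k → E (suc k) ≡ E k + e k) → (∀ k → ∣ E k ∣ ≤ 1ℚ) →
             Cauchy (λ N → sum₁ N f)
  by-parts f e E b sb f≡ E≡ E≤ with slow-bounded b sb 1 | sb 1
  ... | D , D≥0 , q | C , C≥0 , p = dominated T V K D K≥0 D≥0 near step
    where
    T V y : ℕ → ℚ
    T N = sum₁ N f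
    y k = rc k * b k
    V k = T k - E k * y k
    K = (D + C) * 3/2
    K≥0 = 0≤* (0≤+ D≥0 C≥0) (nonNegative⁻¹ 3/2)
    y≤ : ∀ k → ∣ y k ∣ ≤ D * u k
    y≤ k = begin
      ∣ rc k * b k ∣        ≤⟨ ∣*∣≤ {rc k} {_} {b k} (≤-reflexive (0≤p⇒∣p∣≡p (rc≥0 k))) (q k) ⟩
      rc k * (D * w 1 k)    ≡⟨ solve 3 (λ x D w → x :* (D :* w) := D :* (w :* x)) refl (rc k) D (w 1 k) ⟩
      D * u k               ∎
    near : ∀ k → ∣ T k - V k ∣ ≤ D * u k
    near k = begin
      ∣ T k - (T k - E k * y k) ∣   ≡⟨ cong ∣_∣ (solve 2 (λ t z → t :- (t :- z) := z) refl (T k) (E k * y k)) ⟩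
      ∣ E k * y k ∣                 ≤⟨ ∣*∣≤ {E k} {_} {y k} (E≤ k) (y≤ k) ⟩
      1ℚ * (D * u k)                ≡⟨ *-identityˡ (D * u k) ⟩
      D * u k                       ∎
    diff : ∀ k → ∣ y k - y (suc k) ∣ ≤ (D + C) * (w 1 k * (rc k * rc (suc k)))
    diff k = begin
      ∣ x * b k - x′ * b (suc k) ∣             ≡⟨ cong (λ z → ∣ z * b k - x′ * b (suc k) ∣) (sym (rc-step k)) ⟩
      ∣ (x′ + x * x′) * b k - x′ * b (suc k) ∣ ≡⟨ cong ∣_∣ (solve 4 (λ x x′ b b′ → (x′ :+ x :* x′) :* b :- x′ :* b′ := (x :* x′) :* b :+ x′ :* (b :- b′)) refl x x′ (b k) (b (suc k))) ⟩
      ∣ (x * x′) * b k + x′ * (b k - b (suc k)) ∣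
        ≤⟨ ∣+∣≤ {(x * x′) * b k} {_} {x′ * (b k - b (suc k))}
             (∣*∣≤ {x * x′} {_} {b k} (≤-reflexive (0≤p⇒∣p∣≡p (0≤* (rc≥0 k) (rc≥0 (suc k))))) (q k))
             (∣*∣≤ {x′} {_} {b k - b (suc k)} (≤-reflexive (0≤p⇒∣p∣≡p (rc≥0 (suc k))))
               (subst (_≤ C * (w 1 k * x)) (∣-∣-comm (b (suc k)) (b k)) (p k))) ⟩
      (x * x′) * (D * w 1 k) + x′ * (C * (w 1 k * x))
        ≡⟨ solve 5 (λ x x′ D C w → (x :* x′) :* (D :* w) :+ x′ :* (C :* (w :* x)) := (D :+ C) :* (w :* (x :* x′))) refl x x′ D C (w 1 k) ⟩
      (D + C) * (w 1 k * (x * x′))             ∎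
      where
      x = rc k
      x′ = rc (suc k)
    step : ∀ k → ∣ V (suc k) - V k ∣ ≤ K * (u k - u (suc k))
    step k = begin
      ∣ (T k + f (1+ k) - E (suc k) * y (suc k)) - (T k - E k * y k) ∣
        ≡⟨ cong₂ (λ s t → ∣ (T k + s - t * y (suc k)) - (T k - E k * y k) ∣) (f≡ k) (E≡ k) ⟩
      ∣ (T k + e k * rc k * b k - (E k + e k) * y (suc k)) - (T k - E k * (rc k * b k)) ∣
        ≡⟨ cong ∣_∣ (solve 6 (λ t e E x b y′ → (t :+ e :* x :* b :- (E :+ e) :* y′) :- (t :- E :* (x :* b))
             := (E :+ e) :* (x :* b :- y′)) refl (T k) (e k) (E k) (rc k) (b k) (y (suc k))) ⟩
      ∣ (E k + e k) * (y k - y (suc k)) ∣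
        ≤⟨ ∣*∣≤ {E k + e k} {_} {y k - y (suc k)} (subst (λ z → ∣ z ∣ ≤ 1ℚ) (E≡ k) (E≤ (suc k))) (diff k) ⟩
      1ℚ * ((D + C) * (w 1 k * (rc k * rc (suc k))))  ≡⟨ *-identityˡ _ ⟩
      (D + C) * (w 1 k * (rc k * rc (suc k)))         ≡⟨ cong ((D + C) *_) (wxy≡ k) ⟩
      (D + C) * (3/2 * (u k - u (suc k)))             ≡⟨ *-assoc (D + C) 3/2 (u k - u (suc k)) ⟨
      K * (u k - u (suc k))                           ∎

  ∣sign^∣ : ∀ σ n → ∣ ⟦ σ ⟧ ^ n ∣ ≡ 1ℚ
  ∣sign^∣ σ zero    = refl
  ∣sign^∣ σ (suc n) = trans (∣p*q∣≡∣p∣*∣q∣ ⟦ σ ⟧ (⟦ σ ⟧ ^ n)) (trans (cong₂ _*_ (∣σ∣ σ) (∣sign^∣ σ n)) (*-identityˡ 1ℚ))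
    where
    ∣σ∣ : ∀ σ → ∣ ⟦ σ ⟧ ∣ ≡ 1ℚ
    ∣σ∣ Sign.+ = refl
    ∣σ∣ Sign.- = refl

  E₋ : ℕ → ℚ
  E₋ k = ½ * ((- 1ℚ) ^ k - 1ℚ)

  E₋-suc : ∀ k → E₋ (suc k) ≡ E₋ k + (- 1ℚ) ^ suc k
  E₋-suc k = solve 1 (λ s → con ½ :* ((:- con 1ℚ) :* s :- con 1ℚ) := con ½ :* (s :- con 1ℚ) :+ (:- con 1ℚ) :* s) refl ((- 1ℚ) ^ k)

  E₋≤1 : ∀ k → ∣ E₋ k ∣ ≤ 1ℚ
  E₋≤1 k = ∣*∣≤ {½} {½} {(- 1ℚ) ^ k - 1ℚ} ≤-refl (∣+∣≤ {(- 1ℚ) ^ k} {1ℚ} {(- 1ℚ)} (≤-reflexive (∣sign^∣ Sign.- k)) ≤-refl)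

  E₊-suc : ∀ k → - E₋ (suc k) ≡ - E₋ k + (- 1ℚ) ^ k
  E₊-suc k = solve 1 (λ s → :- (con ½ :* ((:- con 1ℚ) :* s :- con 1ℚ)) := :- (con ½ :* (s :- con 1ℚ)) :+ s) refl ((- 1ℚ) ^ k)

  E₊≤1 : ∀ k → ∣ - E₋ k ∣ ≤ 1ℚ
  E₊≤1 k = subst (_≤ 1ℚ) (sym (∣-p∣≡∣p∣ (E₋ k))) (E₋≤1 k)

  ∣term∣ : ∀ e x b {B} → ∣ e ∣ ≡ 1ℚ → 0ℚ ≤ x → x ≤ B → ∣ e * x * b ∣ ≤ B * ∣ b ∣
  ∣term∣ e x b {B} e≡ x≥0 x≤ = begin
    ∣ e * x * b ∣          ≡⟨ ∣p*q∣≡∣p∣*∣q∣ (e * x) b ⟩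
    ∣ e * x ∣ * ∣ b ∣      ≡⟨ cong (_* ∣ b ∣) (trans (∣p*q∣≡∣p∣*∣q∣ e x) (trans (cong₂ _*_ e≡ (0≤p⇒∣p∣≡p x≥0)) (*-identityˡ x))) ⟩
    x * ∣ b ∣              ≤⟨ *-monoʳ-≤-nonNeg ∣ b ∣ {{ ∣-∣-nonNeg b }} x≤ ⟩
    B * ∣ b ∣              ∎

  slow-H : ∀ r → Slow (H r)
  slow-H r = slow-sum (λ k → recip k r) (λ _ → 1ℚ) (slow-const 1ℚ) λ k →
    subst (λ z → ∣ z ∣ ≤ rc k * 1ℚ) (trans (*-identityʳ (1ℚ * recip (1+ k) r)) (*-identityˡ (recip (1+ k) r)))
      (∣term∣ 1ℚ (recip (1+ k) r) 1ℚ refl (recip≥0 (1+ k) r) (recip≤rc k r))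

  slow-H̄ : ∀ r → Slow (H̄ r)
  slow-H̄ r = slow-sum (λ k → alt k * recip k r) (λ _ → 1ℚ) (slow-const 1ℚ) λ k →
    subst (λ z → ∣ z ∣ ≤ rc k * 1ℚ) (*-identityʳ (alt (1+ k) * recip (1+ k) r))
      (∣term∣ (alt (1+ k)) (recip (1+ k) r) 1ℚ (∣sign^∣ Sign.- k) (recip≥0 (1+ k) r) (recip≤rc k r))

  slow-ζ : ∀ is → Slow (ζ-partial is)
  slow-ζ []             = slow-const 1ℚ
  slow-ζ ((s , σ) ∷ is) = slow-sum _ (ζ-partial is) (slow-ζ is) λ k →
    ∣term∣ (⟦ σ ⟧ ^ suc k) (recip (1+ k) s) (ζ-partial is k) (∣sign^∣ σ (suc k)) (recip≥0 (1+ k) s) (recip≤rc k s)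

  -- Σ e_n b_(n-1) / n^s with a unimodular sign e
  series₂ : ∀ (e : ℕ⁺ → ℚ) s (b : ℕ → ℚ) → Slow b → (∀ n → ∣ e n ∣ ≡ 1ℚ) →
            Cauchy (λ N → ∑[1≤ n ≤ N ] e n * recip n (1+ suc s) * b (ℕ⁺.pred n))
  series₂ e s b sb e≡ = absolute _ b sb λ k →
    ∣term∣ (e (1+ k)) (recip (1+ k) (1+ suc s)) (b k) (e≡ (1+ k)) (recip≥0 (1+ k) (1+ suc s)) (recip≤rc² k s)

  series₁ : ∀ (e : ℕ⁺ → ℚ) (E b : ℕ → ℚ) → Slow b →
            (∀ k → E (suc k) ≡ E k + e (1+ k)) → (∀ k → ∣ E k ∣ ≤ 1ℚ) →
            Cauchy (λ N → ∑[1≤ n ≤ N ] e n * recip n (1+ 0) * b (ℕ⁺.pred n))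
  series₁ e E b sb = by-parts _ (λ k → e (1+ k)) E b sb (λ k → cong (λ z → e (1+ k) * z * b k) (recip-1 k))

  ζ-cauchy : ∀ i is → Admissible i → Cauchy (ζ-partial (i ∷ is))
  ζ-cauchy (1+ zero , Sign.+)  is adm = ⊥-elim (adm (refl , refl))
  ζ-cauchy (1+ zero , Sign.-)  is _   = series₁ (λ n → (- 1ℚ) ^ toℕ n) E₋ (ζ-partial is) (slow-ζ is) E₋-suc E₋≤1
  ζ-cauchy (1+ (suc s) , σ)    is _   = series₂ (λ n → ⟦ σ ⟧ ^ toℕ n) s (ζ-partial is) (slow-ζ is) (λ n → ∣sign^∣ σ (toℕ n))

  altS-cauchy : ∀ (h : ℕ → ℚ) → Slow h → ∀ m q →
                Cauchy (λ N → ∑[1≤ n ≤ N ] alt n * recip n q * h (toℕ n) ^ m)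
  altS-cauchy h sh m (1+ zero)  = series₁ alt (λ k → - E₋ k) b (slow-shift (λ k → h k ^ m) (slow-^ h sh m)) E₊-suc E₊≤1
    where
    b : ℕ → ℚ
    b k = h (suc k) ^ m
  altS-cauchy h sh m (1+ suc q) = series₂ alt q b (slow-shift (λ k → h k ^ m) (slow-^ h sh m)) (λ n → ∣sign^∣ Sign.- (ℕ⁺.pred n))
    where
    b : ℕ → ℚ
    b k = h (suc k) ^ m

  S-cauchy : ∀ (h : ℕ → ℚ) → Slow h → ∀ m q → 2 ℕ.≤ toℕ q →
             Cauchy (λ N → ∑[1≤ n ≤ N ] recip n q * h (toℕ n) ^ m)
  S-cauchy h sh m (1+ zero)  (s≤s ())
  S-cauchy h sh m (1+ suc q) _ = absolute (λ n → recip n (1+ suc q) * h (toℕ n) ^ m) b (slow-shift (λ k → h k ^ m) (slow-^ h sh m)) λ k →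
    subst (λ z → ∣ z * b k ∣ ≤ (rc k * rc k) * ∣ b k ∣) (*-identityˡ (recip (1+ k) (1+ suc q)))
      (∣term∣ 1ℚ (recip (1+ k) (1+ suc q)) (b k) refl (recip≥0 (1+ k) (1+ suc q)) (recip≤rc² k q))
    where
    b : ℕ → ℚ
    b k = h (suc k) ^ m

-- In the names S-… the bars are those of the indices r and q.

ζ : (is : List⁺ Entry) → Admissible (head is) → ℝ
ζ is adm = lim (ζ-partial (toList is)) (Convergence.ζ-cauchy (head is) (tail is) adm)

S-rq̄ : (r m q : ℕ⁺) → ℝ
S-rq̄ r m q = lim (λ N → ∑[1≤ n ≤ N ] alt n * recip n q * H r (toℕ n) ^ toℕ m)
                 (Convergence.altS-cauchy (H r) (Convergence.slow-H r) (toℕ m) q)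

S-r̄q : (r m q : ℕ⁺) → 2 ℕ.≤ toℕ q → ℝ
S-r̄q r m q q≥2 = lim (λ N → ∑[1≤ n ≤ N ] recip n q * H̄ r (toℕ n) ^ toℕ m)
                     (Convergence.S-cauchy (H̄ r) (Convergence.slow-H̄ r) (toℕ m) q q≥2)

S-r̄q̄ : (r m q : ℕ⁺) → ℝ
S-r̄q̄ r m q = lim (λ N → ∑[1≤ n ≤ N ] alt n * recip n q * H̄ r (toℕ n) ^ toℕ m)
                 (Convergence.altS-cauchy (H̄ r) (Convergence.slow-H̄ r) (toℕ m) q)

total : List⁺ ℕ⁺ → ℕ
total θ = sum (map toℕ (toList θ))

-- The compositions of suc a + m whose first part is at least suc a: the
-- first part is either suc a itself or at least suc (suc a).
compositionsFrom : (a m : ℕ) → List (List⁺ ℕ⁺)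
compositionsFrom a zero    = ((1+ a) ∷ []) ∷ []
compositionsFrom a (suc m) = map ((1+ a) ∷⁺_) (compositionsFrom 0 m) ++ compositionsFrom (suc a) m

𝒞 : ℕ⁺ → List (List⁺ ℕ⁺)
𝒞 (1+ m) = compositionsFrom 0 m

factorials : List ℕ⁺ → ℕ
factorials θ = product (map (λ t → toℕ t !) θ)

factorials≢0 : ∀ θ → ℕ.NonZero (factorials θ)
factorials≢0 θ = product≢0 (all θ)
  where
  all : ∀ θ → All ℕ.NonZero (map (λ t → toℕ t !) θ)
  all []      = []
  all (t ∷ θ) = (toℕ t ℕ.!≢0) ∷ all θ

multinomial : ℕ⁺ → List⁺ ℕ⁺ → ℚ
multinomial m θ = _/_ (ℤ.+ (toℕ m !)) (factorials (toList θ)) {{ factorials≢0 (toList θ) }}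

-- 𝒞 m lists every composition of m exactly once.
module Compositions where

  from-sound : ∀ a m {θ} → θ ∈ compositionsFrom a m → total θ ≡ suc a ℕ.+ m × suc a ℕ.≤ toℕ (head θ)
  from-sound a zero    (here refl) = refl , ℕ.≤-refl
  from-sound a (suc m) θ∈ with ∈-++⁻ (map ((1+ a) ∷⁺_) (compositionsFrom 0 m)) θ∈
  ... | inj₂ θ∈′ with from-sound (suc a) m θ∈′
  ...   | t , h = trans t (sym (ℕ.+-suc (suc a) m)) , ℕ.<⇒≤ h
  from-sound a (suc m) θ∈ | inj₁ θ∈′ with ∈-map⁻ ((1+ a) ∷⁺_) θ∈′
  ... | θ′ , θ′∈ , refl = cong (suc a ℕ.+_) (proj₁ (from-sound 0 m θ′∈)) , ℕ.≤-refl

  from-complete : ∀ a m θ → total θ ≡ suc a ℕ.+ m → suc a ℕ.≤ toℕ (head θ) → θ ∈ compositionsFrom a m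
  from-complete a m ((1+ h) ∷ ts) t (s≤s a≤h) with ℕ.m≤n⇒m<n∨m≡n a≤h
  from-complete a zero    ((1+ .a) ∷ []) t _ | inj₂ refl = here refl
  from-complete a (suc m) ((1+ .a) ∷ []) t _ | inj₂ refl with ℕ.+-cancelˡ-≡ (suc a) 0 (suc m) t
  ... | ()
  from-complete a m       ((1+ .a) ∷ t₁ ∷ ts) t _ | inj₂ refl with m | ℕ.+-cancelˡ-≡ (suc a) _ m t
  ... | suc m′ | e = ∈-++⁺ˡ (∈-map⁺ ((1+ a) ∷⁺_) (from-complete 0 m′ (t₁ ∷ ts) e (s≤s z≤n)))
  from-complete a zero    ((1+ h) ∷ ts) t _ | inj₁ a<h = ⊥-elim (ℕ.<-irrefl refl (begin-strict
      h                                ≤⟨ ℕ.m≤m+n h (sum (map toℕ ts)) ⟩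
      h ℕ.+ sum (map toℕ ts)           ≡⟨ ℕ.suc-injective t ⟩
      a ℕ.+ 0                          ≡⟨ ℕ.+-identityʳ a ⟩
      a                                <⟨ a<h ⟩
      h                                ∎))
    where open ℕ.≤-Reasoning
  from-complete a (suc m) ((1+ h) ∷ ts) t _ | inj₁ a<h =
    ∈-++⁺ʳ _ (from-complete (suc a) m ((1+ h) ∷ ts) (trans t (ℕ.+-suc (suc a) m)) (s≤s a<h))

  sound : ∀ m {θ} → θ ∈ 𝒞 m → total θ ≡ toℕ m
  sound (1+ m) θ∈ = proj₁ (from-sound 0 m θ∈)

  complete : ∀ m θ → total θ ≡ toℕ m → θ ∈ 𝒞 m
  complete (1+ m) θ t = from-complete 0 m θ t (s≤s z≤n)

  from-unique : ∀ a m → Unique (compositionsFrom a m)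
  from-unique a zero    = [] AllPairs.∷ AllPairs.[]
  from-unique a (suc m) = Unique.++⁺ (Unique.map⁺ ∷⁺-injective (from-unique 0 m)) (from-unique (suc a) m) disjoint
    where
    ∷⁺-injective : ∀ {θ θ′} → (1+ a) ∷⁺ θ ≡ (1+ a) ∷⁺ θ′ → θ ≡ θ′
    ∷⁺-injective refl = refl
    disjoint : ∀ {θ} → ¬ (θ ∈ map ((1+ a) ∷⁺_) (compositionsFrom 0 m) × θ ∈ compositionsFrom (suc a) m)
    disjoint (p , q) with ∈-map⁻ ((1+ a) ∷⁺_) p
    ... | _ , _ , refl = ℕ.<-irrefl refl (proj₂ (from-sound (suc a) m q))

  unique : ∀ m → Unique (𝒞 m)
  unique (1+ m) = from-unique 0 m

{-# OPTIONS --safe #-}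

-- The identities already hold between the N-th partial sums, so no limit is
-- taken.  In terms of divided powers γ n x = xⁿ / n! the multinomial theorem
-- reads: γ m (a(1) + ⋯ + a(N)) is the sum, over the compositions θ of m, of the
-- nested sums of γ θ₁ (a n₁) ⋯ γ θ_p (a n_p) over N ≥ n₁ > ⋯ > n_p ≥ 1.  It
-- follows from the binomial theorem by induction on N.  For a(n) = σⁿ / n^r the
-- nested sums are truncated zeta values, and splitting n₁ ≤ n into n₁ ≤ n - 1
-- and n₁ = n gives the two zeta values attached to each composition.

module Submission where

open import Defs

module PartialSums where

  import Data.Integer.Base as ℤ
  import Data.Integer.Properties as ℤ
  open import Algebra.Bundles using (module CommutativeRing)
  open import Data.List.Base using (List; []; _∷_; _++_; map; foldr)
  open import Data.List.NonEmpty.Base using (List⁺; _∷_; _∷⁺_; head; tail; toList)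
  open import Data.Nat.Base as ℕ using (ℕ; zero; suc; _!)
  import Data.Nat.Properties as ℕ
  open import Data.Product.Base using (_,_)
  open import Data.Rational.Base using (ℚ; 0ℚ; 1ℚ; _+_; _*_; -_; _-_; _/_; ∣_∣; _<_; +-*-rawSemiring)
  open import Data.Rational.Properties
  open import Data.Rational.Solver using (module +-*-Solver)
  import Data.Rational.Unnormalised.Base as ℚᵘ
  import Data.Rational.Unnormalised.Properties as ℚᵘ
  open import Data.Sign.Base as Sign using (Sign)
  open import Relation.Binary.PropositionalEquality
    using (_≡_; refl; sym; trans; cong; cong₂; subst; module ≡-Reasoning)
  open import Algebra.Properties.CommutativeSemiring.Exp
    (CommutativeRing.commutativeSemiring +-*-commutativeRing)
    using (^-homo-*; ^-assocʳ; ^-distrib-*)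
  open import Algebra.Definitions.RawSemiring +-*-rawSemiring using (_^_)
  open Convergence using (rc; rc-step; recip-suc; recip-1; unit-fraction-*; /-homo-*)
  open +-*-Solver using (solve; con; _:=_; _:+_; _:*_; :-_)
  open ≡-Reasoning

  -- Finite sums

  sumℚ : {A : Set} → List A → (A → ℚ) → ℚ
  sumℚ xs f = foldr (λ a s → f a + s) 0ℚ xs

  sumℚ-cong : {A : Set} (xs : List A) {f g : A → ℚ} → (∀ a → f a ≡ g a) → sumℚ xs f ≡ sumℚ xs g
  sumℚ-cong []       e = refl
  sumℚ-cong (x ∷ xs) e = cong₂ _+_ (e x) (sumℚ-cong xs e)

  sumℚ-0 : {A : Set} (xs : List A) → sumℚ xs (λ _ → 0ℚ) ≡ 0ℚ
  sumℚ-0 []       = refl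
  sumℚ-0 (x ∷ xs) = trans (+-identityˡ _) (sumℚ-0 xs)

  sumℚ-++ : {A : Set} (xs ys : List A) (f : A → ℚ) → sumℚ (xs ++ ys) f ≡ sumℚ xs f + sumℚ ys f
  sumℚ-++ []       ys f = sym (+-identityˡ _)
  sumℚ-++ (x ∷ xs) ys f = trans (cong (f x +_) (sumℚ-++ xs ys f)) (sym (+-assoc (f x) _ _))

  sumℚ-map : {A B : Set} (g : A → B) (xs : List A) (f : B → ℚ) → sumℚ (map g xs) f ≡ sumℚ xs (λ a → f (g a))
  sumℚ-map g []       f = refl
  sumℚ-map g (x ∷ xs) f = cong (f (g x) +_) (sumℚ-map g xs f)

  sumℚ-+ : {A : Set} (xs : List A) (f g : A → ℚ) → sumℚ xs (λ a → f a + g a) ≡ sumℚ xs f + sumℚ xs g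
  sumℚ-+ []       f g = refl
  sumℚ-+ (x ∷ xs) f g = trans (cong (f x + g x +_) (sumℚ-+ xs f g))
    (solve 4 (λ a b c d → (a :+ b) :+ (c :+ d) := (a :+ c) :+ (b :+ d)) refl (f x) (g x) _ _)

  sumℚ-* : {A : Set} (c : ℚ) (xs : List A) (f : A → ℚ) → sumℚ xs (λ a → c * f a) ≡ c * sumℚ xs f
  sumℚ-* c []       f = sym (*-zeroʳ c)
  sumℚ-* c (x ∷ xs) f = trans (cong (c * f x +_) (sumℚ-* c xs f)) (sym (*-distribˡ-+ c (f x) _))

  sum₁-cong : ∀ N {f g : ℕ⁺ → ℚ} → (∀ n → f n ≡ g n) → sum₁ N f ≡ sum₁ N g
  sum₁-cong zero    e = refl
  sum₁-cong (suc N) e = cong₂ _+_ (sum₁-cong N e) (e (1+ N))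

  sum₁-* : ∀ N (c : ℚ) (f : ℕ⁺ → ℚ) → sum₁ N (λ n → c * f n) ≡ c * sum₁ N f
  sum₁-* zero    c f = sym (*-zeroʳ c)
  sum₁-* (suc N) c f = trans (cong (_+ c * f (1+ N)) (sum₁-* N c f)) (sym (*-distribˡ-+ c _ _))

  -- Divided powers

  γ : ℕ → ℚ → ℚ
  γ zero    x = 1ℚ
  γ (suc n) x = rc n * (x * γ n x)

  -- The embedding of the naturals, by recursion so that `ι (suc n)` unfolds to `1ℚ + ι n`, which
  -- the solver can rearrange.
  ι : ℕ → ℚ
  ι zero    = 0ℚ
  ι (suc n) = 1ℚ + ι n

  ι-*-rc : ∀ n → ι (suc n) * rc n ≡ 1ℚ
  ι-*-rc zero    = refl
  ι-*-rc (suc n) = begin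
    (1ℚ + i) * y      ≡⟨ solve 2 (λ i y → (con 1ℚ :+ i) :* y := i :* y :+ con 1ℚ :* y) refl i y ⟩
    -- The factor 1 becomes `i * x` by the induction hypothesis, so that `i` factors out of the left
    -- side of `rc-step`.
    i * y + 1ℚ * y    ≡⟨ cong (λ z → i * y + z * y) (ι-*-rc n) ⟨
    i * y + i * x * y ≡⟨ solve 3 (λ i x y → i :* y :+ i :* x :* y := i :* (y :+ x :* y)) refl i x y ⟩
    i * (y + x * y)   ≡⟨ cong (i *_) (rc-step n) ⟩
    i * x             ≡⟨ ι-*-rc n ⟩
    1ℚ                ∎
    where
    i = ι (suc n)
    x = rc n
    y = rc (suc n)

  -- Lets the degree act on the summands of the binomial sum as multiplication by one of the two
  -- variables.
  ι-*-γ : ∀ n x → ι (suc n) * γ (suc n) x ≡ x * γ n x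
  ι-*-γ n x = begin
    ι (suc n) * (rc n * (x * γ n x)) ≡⟨ *-assoc (ι (suc n)) (rc n) _ ⟨
    ι (suc n) * rc n * (x * γ n x)   ≡⟨ cong (_* (x * γ n x)) (ι-*-rc n) ⟩
    1ℚ * (x * γ n x)                 ≡⟨ *-identityˡ _ ⟩
    x * γ n x                        ∎

  -- binomialFrom a m x y = ∑_{j ≤ m} γ (a + j) x * γ (m - j) y
  binomialFrom : ℕ → ℕ → ℚ → ℚ → ℚ
  binomialFrom a zero    x y = γ a x
  binomialFrom a (suc m) x y = γ a x * γ (suc m) y + binomialFrom (suc a) m x y

  -- The degree a + m + 1 is split as (a + j) + (m + 1 - j) in the j-th summand.
  ι-*-binomialFrom : ∀ a m x y → (ι a + ι (suc m)) * binomialFrom a (suc m) x y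
                               ≡ ι a * (γ a x * γ (suc m) y) + (x + y) * binomialFrom a m x y
  ι-*-binomialFrom a zero x y = begin
    (i + 1ℚ) * (G * g + G₁)
      ≡⟨ solve 4 (λ i G g G₁ → (i :+ con 1ℚ) :* (G :* g :+ G₁)
           := i :* (G :* g) :+ (G :* (con 1ℚ :* g) :+ (con 1ℚ :+ i) :* G₁)) refl i G g G₁ ⟩
    i * (G * g) + (G * (1ℚ * g) + (1ℚ + i) * G₁)
      ≡⟨ cong₂ (λ u v → i * (G * g) + (G * u + v)) (ι-*-γ 0 y) (ι-*-γ a x) ⟩
    i * (G * g) + (G * (y * 1ℚ) + x * G)
      ≡⟨ solve 5 (λ i G g x y → i :* (G :* g) :+ (G :* (y :* con 1ℚ) :+ x :* G)
           := i :* (G :* g) :+ (x :+ y) :* G) refl i G g x y ⟩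
    i * (G * g) + (x + y) * G ∎
    where
    i = ι a
    G = γ a x
    g = γ 1 y
    G₁ = γ (suc a) x
  ι-*-binomialFrom a (suc m) x y = begin
    (i + (1ℚ + j)) * (G * g₁ + B₁)
      -- In the tail one unit of degree moves from `y` to `x`: the weight becomes `(1ℚ + i) + j`, as
      -- the induction hypothesis for `suc a` needs it.
      ≡⟨ solve 5 (λ i j G g₁ B₁ → (i :+ (con 1ℚ :+ j)) :* (G :* g₁ :+ B₁)
           := i :* (G :* g₁) :+ G :* ((con 1ℚ :+ j) :* g₁) :+ ((con 1ℚ :+ i) :+ j) :* B₁) refl i j G g₁ B₁ ⟩
    i * (G * g₁) + G * ((1ℚ + j) * g₁) + (1ℚ + i + j) * B₁
      ≡⟨ cong₂ (λ u v → i * (G * g₁) + G * u + v) (ι-*-γ (suc m) y) (ι-*-binomialFrom (suc a) m x y) ⟩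
    i * (G * g₁) + G * (y * g) + ((1ℚ + i) * (G₁ * g) + (x + y) * B₀)
      ≡⟨ cong (λ u → i * (G * g₁) + G * (y * g) + (u + (x + y) * B₀))
           (trans (sym (*-assoc (1ℚ + i) G₁ g)) (cong (_* g) (ι-*-γ a x))) ⟩
    i * (G * g₁) + G * (y * g) + (x * G * g + (x + y) * B₀)
      -- `x * G * g` and `G * (y * g)` add up to `x + y` times the first summand of
      -- `binomialFrom a (suc m) x y`.
      ≡⟨ solve 7 (λ i G g₁ g x y B₀ → i :* (G :* g₁) :+ G :* (y :* g) :+ (x :* G :* g :+ (x :+ y) :* B₀)
           := i :* (G :* g₁) :+ (x :+ y) :* (G :* g :+ B₀)) refl i G g₁ g x y B₀ ⟩
    i * (G * g₁) + (x + y) * (G * g + B₀) ∎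
    where
    i = ι a
    j = ι (suc m)
    G = γ a x
    G₁ = γ (suc a) x
    g = γ (suc m) y
    g₁ = γ (suc (suc m)) y
    B₀ = binomialFrom (suc a) m x y
    B₁ = binomialFrom (suc a) (suc m) x y

  -- For `a = 0` the boundary term of `ι-*-binomialFrom` has the factor `ι 0 = 0`. What remains is
  -- (m + 1) B(m + 1) = (x + y) B(m), the recursion of `γ` at x + y.
  γ-binomial : ∀ m x y → binomialFrom 0 m x y ≡ γ m (x + y)
  γ-binomial zero    x y = refl
  γ-binomial (suc m) x y = begin
    B                             ≡⟨ *-identityˡ B ⟨
    1ℚ * B                        ≡⟨ cong (_* B) (ι-*-rc m) ⟨
    ι (suc m) * rc m * B          ≡⟨ solve 3 (λ j c B → j :* c :* B := c :* ((con 0ℚ :+ j) :* B)) refl (ι (suc m)) (rc m) B ⟩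
    rc m * ((0ℚ + ι (suc m)) * B) ≡⟨ cong (rc m *_) (ι-*-binomialFrom 0 m x y) ⟩
    rc m * (0ℚ * (1ℚ * g) + (x + y) * binomialFrom 0 m x y)
      ≡⟨ cong (rc m *_) (trans (cong (_+ (x + y) * binomialFrom 0 m x y) (*-zeroˡ (1ℚ * g))) (+-identityˡ _)) ⟩
    rc m * ((x + y) * binomialFrom 0 m x y) ≡⟨ cong (λ z → rc m * ((x + y) * z)) (γ-binomial m x y) ⟩
    γ (suc m) (x + y)             ∎
    where
    B = binomialFrom 0 (suc m) x y
    g = γ (suc m) y

  -- Compositions

  nested : (ℕ⁺ → ℚ) → List ℕ⁺ → ℕ → ℚ
  nested a []      N = 1ℚ
  nested a (t ∷ θ) N = ∑[1≤ n ≤ N ] γ (toℕ t) (a n) * nested a θ (ℕ⁺.pred n)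

  -- For `x = a (1+ N)` and `y = sum₁ N a` this is the part of the nested sums with n₁ = N + 1.
  -- Removing a first part equal to b + 1 leaves a composition of the rest, summed by `hyp`; larger
  -- first parts give the same recursion as `binomialFrom`.
  sum-top-index : ∀ a x y N →
    (∀ m → sumℚ (compositionsFrom 0 m) (λ θ → nested a (toList θ) N) ≡ γ (suc m) y) →
    ∀ b m → sumℚ (compositionsFrom b m) (λ θ → γ (toℕ (head θ)) x * nested a (tail θ) N)
            ≡ binomialFrom (suc b) m x y
  sum-top-index a x y N hyp b zero    = trans (+-identityʳ _) (*-identityʳ _)
  sum-top-index a x y N hyp b (suc m) = begin
    sumℚ (map ((1+ b) ∷⁺_) (compositionsFrom 0 m) ++ compositionsFrom (suc b) m) f
      ≡⟨ sumℚ-++ (map ((1+ b) ∷⁺_) (compositionsFrom 0 m)) _ f ⟩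
    sumℚ (map ((1+ b) ∷⁺_) (compositionsFrom 0 m)) f + sumℚ (compositionsFrom (suc b) m) f
      ≡⟨ cong₂ _+_ (trans (sumℚ-map ((1+ b) ∷⁺_) (compositionsFrom 0 m) f)
                          (sumℚ-* (γ (suc b) x) (compositionsFrom 0 m) _))
                   (sum-top-index a x y N hyp (suc b) m) ⟩
    γ (suc b) x * sumℚ (compositionsFrom 0 m) (λ θ → nested a (toList θ) N) + binomialFrom (suc (suc b)) m x y
      ≡⟨ cong (λ z → γ (suc b) x * z + binomialFrom (suc (suc b)) m x y) (hyp m) ⟩
    γ (suc b) x * γ (suc m) y + binomialFrom (suc (suc b)) m x y ∎
    where
    f : List⁺ ℕ⁺ → ℚ
    f θ = γ (toℕ (head θ)) x * nested a (tail θ) N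

  γ-multinomial : ∀ a N m → sumℚ (compositionsFrom 0 m) (λ θ → nested a (toList θ) N) ≡ γ (suc m) (sum₁ N a)
  -- Every composition here is nonempty, so its nested sum over an empty range is 0.
  γ-multinomial a zero    m = trans (sumℚ-0 (compositionsFrom 0 m))
    (sym (trans (cong (rc m *_) (*-zeroˡ (γ m 0ℚ))) (*-zeroʳ (rc m))))
  γ-multinomial a (suc N) m = begin
    sumℚ (compositionsFrom 0 m) (λ θ → nested a (toList θ) N + γ (toℕ (head θ)) x * nested a (tail θ) N)
      ≡⟨ sumℚ-+ (compositionsFrom 0 m) (λ θ → nested a (toList θ) N) (λ θ → γ (toℕ (head θ)) x * nested a (tail θ) N) ⟩
    sumℚ (compositionsFrom 0 m) (λ θ → nested a (toList θ) N)
      + sumℚ (compositionsFrom 0 m) (λ θ → γ (toℕ (head θ)) x * nested a (tail θ) N)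
      ≡⟨ cong₂ _+_ (γ-multinomial a N m) (sum-top-index a x y N (γ-multinomial a N) 0 m) ⟩
    -- First parts are at least 1, so the tuples with n₁ = N + 1 miss the j = 0 summand of the
    -- binomial sum; those with n₁ ≤ N supply it.
    γ (suc m) y + binomialFrom 1 m x y       ≡⟨ cong (_+ binomialFrom 1 m x y) (*-identityˡ (γ (suc m) y)) ⟨
    binomialFrom 0 (suc m) x y               ≡⟨ γ-binomial (suc m) x y ⟩
    γ (suc m) (x + y)                        ≡⟨ cong (γ (suc m)) (+-comm x y) ⟩
    γ (suc m) (y + x)                        ∎
    where
    x = a (1+ N)
    y = sum₁ N a

  -- Factorials

  infix 9 1/_!
  1/_! : ℕ → ℚ
  1/ n ! = _/_ (ℤ.+ 1) (n !) {{ n ℕ.!≢0 }}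

  γ≡ : ∀ n x → γ n x ≡ 1/ n ! * x ^ n
  γ≡ zero    x = refl
  γ≡ (suc n) x = begin
    rc n * (x * γ n x)             ≡⟨ cong (λ z → rc n * (x * z)) (γ≡ n x) ⟩
    rc n * (x * (1/ n ! * x ^ n))  ≡⟨ solve 4 (λ c x f p → c :* (x :* (f :* p)) := c :* f :* (x :* p)) refl (rc n) x (1/ n !) (x ^ n) ⟩
    rc n * 1/ n ! * x ^ suc n      ≡⟨ cong (_* x ^ suc n) (unit-fraction-* (suc n) (n !) {{ _ }} {{ n ℕ.!≢0 }} {{ suc n ℕ.!≢0 }}) ⟨
    1/ suc n ! * x ^ suc n         ∎

  1/factorials : List ℕ⁺ → ℚ
  1/factorials θ = _/_ (ℤ.+ 1) (factorials θ) {{ factorials≢0 θ }}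

  1/factorials-∷ : ∀ t θ → 1/factorials (t ∷ θ) ≡ 1/ toℕ t ! * 1/factorials θ
  1/factorials-∷ t θ = unit-fraction-* (toℕ t !) (factorials θ)
    {{ toℕ t ℕ.!≢0 }} {{ factorials≢0 θ }} {{ factorials≢0 (t ∷ θ) }}

  /≡*1/ : ∀ k n .{{_ : ℕ.NonZero n}} → (ℤ.+ k) / n ≡ (ℤ.+ k) / 1 * ((ℤ.+ 1) / n)
  /≡*1/ k (suc n) = sym (trans (/-homo-* (ℤ.+ k) (ℤ.+ 1) 0 n)
    (/-cong (ℤ.*-identityʳ (ℤ.+ k)) (ℕ.*-identityˡ (suc n))))

  n/n≡1 : ∀ n .{{_ : ℕ.NonZero n}} → (ℤ.+ n) / n ≡ 1ℚ
  n/n≡1 (suc n) = toℚᵘ-injective (ℚᵘ.≃-trans (toℚᵘ-fromℚᵘ (ℚᵘ.mkℚᵘ (ℤ.+ suc n) n))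
    (ℚᵘ.*≡* (ℤ.*-comm (ℤ.+ suc n) (ℤ.+ 1))))

  multinomial≡ : ∀ m θ → multinomial m θ ≡ (ℤ.+ (toℕ m !)) / 1 * 1/factorials (toList θ)
  multinomial≡ m θ = /≡*1/ (toℕ m !) (factorials (toList θ)) {{ factorials≢0 (toList θ) }}

  !*γ : ∀ n x → (ℤ.+ (n !)) / 1 * γ n x ≡ x ^ n
  !*γ n x = begin
    (ℤ.+ (n !)) / 1 * γ n x              ≡⟨ cong ((ℤ.+ (n !)) / 1 *_) (γ≡ n x) ⟩
    (ℤ.+ (n !)) / 1 * (1/ n ! * x ^ n)   ≡⟨ *-assoc ((ℤ.+ (n !)) / 1) (1/ n !) (x ^ n) ⟨
    (ℤ.+ (n !)) / 1 * 1/ n ! * x ^ n     ≡⟨ cong (_* x ^ n) (/≡*1/ (n !) (n !) {{ n ℕ.!≢0 }}) ⟨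
    (_/_ (ℤ.+ (n !)) (n !) {{ n ℕ.!≢0 }}) * x ^ n  ≡⟨ cong (_* x ^ n) (n/n≡1 (n !) {{ n ℕ.!≢0 }}) ⟩
    1ℚ * x ^ n                           ≡⟨ *-identityˡ (x ^ n) ⟩
    x ^ n                                ∎

  -- Signed reciprocal powers

  ⟦⟧-homo-* : ∀ σ τ → ⟦ σ Sign.* τ ⟧ ≡ ⟦ σ ⟧ * ⟦ τ ⟧
  ⟦⟧-homo-* Sign.+ τ      = sym (*-identityˡ ⟦ τ ⟧)
  ⟦⟧-homo-* Sign.- Sign.+ = refl
  ⟦⟧-homo-* Sign.- Sign.- = refl

  ⟦⟧-homo-^ : ∀ σ n → ⟦ σ ^ˢ n ⟧ ≡ ⟦ σ ⟧ ^ n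
  ⟦⟧-homo-^ σ zero    = refl
  ⟦⟧-homo-^ σ (suc n) = trans (⟦⟧-homo-* σ (σ ^ˢ n)) (cong (⟦ σ ⟧ *_) (⟦⟧-homo-^ σ n))

  1^ : ∀ n → 1ℚ ^ n ≡ 1ℚ
  1^ zero    = refl
  1^ (suc n) = trans (*-identityˡ (1ℚ ^ n)) (1^ n)

  ^-comm : ∀ x m n → (x ^ m) ^ n ≡ (x ^ n) ^ m
  ^-comm x m n = trans (^-assocʳ x m n) (trans (cong (x ^_) (ℕ.*-comm m n)) (sym (^-assocʳ x n m)))

  -- Makes `recip-+` and `recip-*` instances of the exponent laws.
  recip≡^ : ∀ n s → recip n s ≡ rc (ℕ⁺.pred n) ^ toℕ s
  recip≡^ (1+ k) (1+ zero)  = trans (recip-1 k) (sym (*-identityʳ (rc k)))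
  recip≡^ (1+ k) (1+ suc s) = trans (recip-suc k s) (cong (rc k *_) (recip≡^ (1+ k) (1+ s)))

  recip-+ : ∀ n s t → recip n (s +⁺ t) ≡ recip n s * recip n t
  recip-+ n s t = begin
    recip n (s +⁺ t)            ≡⟨ recip≡^ n (s +⁺ t) ⟩
    x ^ (toℕ s ℕ.+ toℕ t)       ≡⟨ ^-homo-* x (toℕ s) (toℕ t) ⟩
    x ^ toℕ s * x ^ toℕ t       ≡⟨ cong₂ _*_ (recip≡^ n s) (recip≡^ n t) ⟨
    recip n s * recip n t       ∎
    where x = rc (ℕ⁺.pred n)

  recip-* : ∀ n s t → recip n (s *⁺ t) ≡ recip n s ^ toℕ t
  recip-* n s t = begin
    recip n (s *⁺ t)            ≡⟨ recip≡^ n (s *⁺ t) ⟩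
    x ^ (toℕ s ℕ.* toℕ t)       ≡⟨ ^-assocʳ x (toℕ s) (toℕ t) ⟨
    (x ^ toℕ s) ^ toℕ t         ≡⟨ cong (_^ toℕ t) (recip≡^ n s) ⟨
    recip n s ^ toℕ t           ∎
    where x = rc (ℕ⁺.pred n)

  term : Sign → ℕ⁺ → ℕ⁺ → ℚ
  term σ s n = ⟦ σ ⟧ ^ toℕ n * recip n s

  -- Merges the factors of two coinciding summation indices into one entry; this produces the
  -- exponent q + rθ₁ of the second zeta value.
  term-* : ∀ σ τ s t n → term (σ Sign.* τ) (s +⁺ t) n ≡ term σ s n * term τ t n
  term-* σ τ s t n = begin
    ⟦ σ Sign.* τ ⟧ ^ toℕ n * recip n (s +⁺ t)
      ≡⟨ cong₂ _*_ (trans (cong (_^ toℕ n) (⟦⟧-homo-* σ τ)) (^-distrib-* ⟦ σ ⟧ ⟦ τ ⟧ (toℕ n))) (recip-+ n s t) ⟩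
    ⟦ σ ⟧ ^ toℕ n * ⟦ τ ⟧ ^ toℕ n * (recip n s * recip n t)
      ≡⟨ solve 4 (λ a b c d → a :* b :* (c :* d) := a :* c :* (b :* d)) refl
           (⟦ σ ⟧ ^ toℕ n) (⟦ τ ⟧ ^ toℕ n) (recip n s) (recip n t) ⟩
    term σ s n * term τ t n ∎

  -- Since (σⁿ)ᵗ = (σᵗ)ⁿ, a power of a term is again a term. The exponents rθⱼ and the signs
  -- attached to θⱼ arise here.
  term-^ : ∀ σ s t n → term (σ ^ˢ toℕ t) (s *⁺ t) n ≡ term σ s n ^ toℕ t
  term-^ σ s t n = begin
    ⟦ σ ^ˢ toℕ t ⟧ ^ toℕ n * recip n (s *⁺ t)
      ≡⟨ cong₂ _*_ (trans (cong (_^ toℕ n) (⟦⟧-homo-^ σ (toℕ t))) (^-comm ⟦ σ ⟧ (toℕ t) (toℕ n))) (recip-* n s t) ⟩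
    (⟦ σ ⟧ ^ toℕ n) ^ toℕ t * recip n s ^ toℕ t
      ≡⟨ ^-distrib-* (⟦ σ ⟧ ^ toℕ n) (recip n s) (toℕ t) ⟨
    term σ s n ^ toℕ t ∎

  -- Alternating sums carry (-1)ⁿ⁻¹ but zeta values σⁿ; this shift is the origin of the global signs
  -- in all three identities.
  alt≡ : ∀ n → alt n ≡ (- 1ℚ) * ⟦ Sign.- ⟧ ^ toℕ n
  alt≡ (1+ k) = solve 1 (λ s → s := con (- 1ℚ) :* (con (- 1ℚ) :* s)) refl ((- 1ℚ) ^ k)

  H≡ : ∀ r N → H r N ≡ sum₁ N (term Sign.+ r)
  H≡ r N = sum₁-cong N λ n → sym (trans (cong (_* recip n r) (1^ (toℕ n))) (*-identityˡ (recip n r)))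

  alt*recip≡ : ∀ n s → alt n * recip n s ≡ (- 1ℚ) * term Sign.- s n
  alt*recip≡ n s = trans (cong (_* recip n s) (alt≡ n)) (*-assoc (- 1ℚ) (⟦ Sign.- ⟧ ^ toℕ n) (recip n s))

  H̄≡ : ∀ r N → H̄ r N ≡ (- 1ℚ) * sum₁ N (term Sign.- r)
  H̄≡ r N = trans (sum₁-cong N λ n → alt*recip≡ n r) (sum₁-* N (- 1ℚ) (term Sign.- r))

  H̄^ : ∀ r N m → H̄ r N ^ m ≡ (- 1ℚ) ^ m * sum₁ N (term Sign.- r) ^ m
  H̄^ r N m = trans (cong (_^ m) (H̄≡ r N)) (^-distrib-* (- 1ℚ) _ m)

  -- Partial sums of the zeta values

  -- `σ` is the sign inside the harmonic sum and `ρ` that of the outer sum. `τ` and `κ` are tied to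
  -- them by propositional equalities, so that each instance can have its signs exactly as its
  -- identity writes them.
  module Expansion (m r q : ℕ⁺) (σ ρ : Sign) (τ κ : ℕ⁺ → Sign)
                   (τ≡ : ∀ t → τ t ≡ σ ^ˢ toℕ t) (κ≡ : ∀ t → κ t ≡ ρ Sign.* τ t) where

    entries : List ℕ⁺ → List Entry
    entries = map (λ t → r *⁺ t , τ t)

    -- Each `γ` splits off a factor 1/t! independent of the summation index; by `term-^` the
    -- remaining power is the factor of one entry.
    nested≡ζ : ∀ θ N → nested (term σ r) θ N ≡ 1/factorials θ * ζ-partial (entries θ) N
    nested≡ζ []      N = refl
    nested≡ζ (t ∷ θ) N = trans (sum₁-cong N summand) (sum₁-* N (1/factorials (t ∷ θ)) _)
      where
      summand : ∀ n → γ (toℕ t) (term σ r n) * nested (term σ r) θ (ℕ⁺.pred n)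
                ≡ 1/factorials (t ∷ θ) * (term (τ t) (r *⁺ t) n * ζ-partial (entries θ) (ℕ⁺.pred n))
      summand n = begin
        γ (toℕ t) (term σ r n) * nested (term σ r) θ (ℕ⁺.pred n)
          ≡⟨ cong₂ _*_ (γ≡ (toℕ t) (term σ r n)) (nested≡ζ θ (ℕ⁺.pred n)) ⟩
        1/ toℕ t ! * term σ r n ^ toℕ t * (1/factorials θ * Z)
          ≡⟨ solve 4 (λ a b c d → a :* b :* (c :* d) := a :* c :* (b :* d)) refl
               (1/ toℕ t !) (term σ r n ^ toℕ t) (1/factorials θ) Z ⟩
        1/ toℕ t ! * 1/factorials θ * (term σ r n ^ toℕ t * Z)
          ≡⟨ cong₂ (λ u v → u * (v * Z)) (1/factorials-∷ t θ)
               (trans (cong (λ s → term s (r *⁺ t) n) (τ≡ t)) (term-^ σ r t n)) ⟨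
        1/factorials (t ∷ θ) * (term (τ t) (r *⁺ t) n * Z) ∎
        where Z = ζ-partial (entries θ) (ℕ⁺.pred n)

    -- The factor m! cancels the denominator of `γ (toℕ m)` and turns the factorials split off in
    -- `nested≡ζ` into the multinomial coefficient.
    multinomial-ζ : ∀ N → sumℚ (𝒞 m) (λ θ → multinomial m θ * ζ-partial (entries (toList θ)) N)
                    ≡ sum₁ N (term σ r) ^ toℕ m
    multinomial-ζ N = begin
      sumℚ (𝒞 m) (λ θ → multinomial m θ * ζ-partial (entries (toList θ)) N)
        ≡⟨ sumℚ-cong (𝒞 m) (λ θ → begin
             multinomial m θ * ζ-partial (entries (toList θ)) N
               ≡⟨ cong (_* ζ-partial (entries (toList θ)) N) (multinomial≡ m θ) ⟩
             m! * 1/factorials (toList θ) * ζ-partial (entries (toList θ)) N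
               ≡⟨ *-assoc m! (1/factorials (toList θ)) _ ⟩
             m! * (1/factorials (toList θ) * ζ-partial (entries (toList θ)) N)
               ≡⟨ cong (m! *_) (nested≡ζ (toList θ) N) ⟨
             m! * nested (term σ r) (toList θ) N ∎) ⟩
      sumℚ (𝒞 m) (λ θ → m! * nested (term σ r) (toList θ) N)  ≡⟨ sumℚ-* m! (𝒞 m) _ ⟩
      m! * sumℚ (𝒞 m) (λ θ → nested (term σ r) (toList θ) N)  ≡⟨ cong (m! *_) (γ-multinomial (term σ r) N (ℕ⁺.pred m)) ⟩
      m! * γ (toℕ m) (sum₁ N (term σ r))                      ≡⟨ !*γ (toℕ m) (sum₁ N (term σ r)) ⟩
      sum₁ N (term σ r) ^ toℕ m                               ∎
      where m! = (ℤ.+ (toℕ m !)) / 1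

    ζ-pair : List⁺ ℕ⁺ → ℕ → ℚ
    ζ-pair θ N = ζ-partial ((q , ρ) ∷ entries (toList θ)) N
               + ζ-partial ((q +⁺ r *⁺ head θ , κ (head θ)) ∷ entries (tail θ)) N

    -- At n₁ = N + 1 the first zeta value contributes n₂ ≤ N, and the merged index of the second
    -- stands for n₂ = N + 1. Together n₂ runs up to N + 1.
    ζ-pair-suc : ∀ θ N → ζ-pair θ (suc N)
                 ≡ ζ-pair θ N + term ρ q (1+ N) * ζ-partial (entries (toList θ)) (suc N)
    ζ-pair-suc θ@(t ∷ ts) N = begin
      X + c * Z + (Y + term (κ t) (q +⁺ r *⁺ t) n * Z′)
        ≡⟨ cong (λ u → X + c * Z + (Y + u * Z′))
             (trans (cong (λ s → term s (q +⁺ r *⁺ t) n) (κ≡ t)) (term-* ρ (τ t) q (r *⁺ t) n)) ⟩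
      X + c * Z + (Y + c * d * Z′)
        ≡⟨ solve 6 (λ X Y c d Z Z′ → X :+ c :* Z :+ (Y :+ c :* d :* Z′) := X :+ Y :+ c :* (Z :+ d :* Z′)) refl X Y c d Z Z′ ⟩
      -- `Z + d * Z′` is `ζ-partial (entries (toList θ)) (suc N)` by unfolding.
      X + Y + c * (Z + d * Z′) ∎
      where
      n = 1+ N
      c = term ρ q n
      d = term (τ t) (r *⁺ t) n
      X = ζ-partial ((q , ρ) ∷ entries (toList θ)) N
      Y = ζ-partial ((q +⁺ r *⁺ t , κ t) ∷ entries ts) N
      Z = ζ-partial (entries (toList θ)) N
      Z′ = ζ-partial (entries ts) N

    -- Induction on `N`: by `ζ-pair-suc`, and `multinomial-ζ` at `suc N`, both sides grow by the
    -- same summand.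
    expansion : ∀ N → sumℚ (𝒞 m) (λ θ → multinomial m θ * ζ-pair θ N)
                ≡ ∑[1≤ n ≤ N ] term ρ q n * sum₁ (toℕ n) (term σ r) ^ toℕ m
    expansion zero    = trans (sumℚ-cong (𝒞 m) (λ θ → *-zeroʳ (multinomial m θ))) (sumℚ-0 (𝒞 m))
    expansion (suc N) = begin
      sumℚ (𝒞 m) (λ θ → multinomial m θ * ζ-pair θ (suc N))
        ≡⟨ sumℚ-cong (𝒞 m) (λ θ → trans (cong (multinomial m θ *_) (ζ-pair-suc θ N))
             (solve 4 (λ u p c z → u :* (p :+ c :* z) := u :* p :+ c :* (u :* z)) refl
               (multinomial m θ) (ζ-pair θ N) c (Z θ))) ⟩
      sumℚ (𝒞 m) (λ θ → multinomial m θ * ζ-pair θ N + c * (multinomial m θ * Z θ))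
        ≡⟨ sumℚ-+ (𝒞 m) (λ θ → multinomial m θ * ζ-pair θ N) (λ θ → c * (multinomial m θ * Z θ)) ⟩
      sumℚ (𝒞 m) (λ θ → multinomial m θ * ζ-pair θ N) + sumℚ (𝒞 m) (λ θ → c * (multinomial m θ * Z θ))
        ≡⟨ cong₂ _+_ (expansion N) (trans (sumℚ-* c (𝒞 m) _) (cong (c *_) (multinomial-ζ (suc N)))) ⟩
      (∑[1≤ n ≤ N ] term ρ q n * sum₁ (toℕ n) (term σ r) ^ toℕ m) + c * sum₁ (suc N) (term σ r) ^ toℕ m ∎
      where
      c = term ρ q (1+ N)
      Z : List⁺ ℕ⁺ → ℚ
      Z θ = ζ-partial (entries (toList θ)) (suc N)

  -- From partial sums to limits

  approx≡⇒≃ : ∀ {x y} → (∀ k → approx x k ≡ approx y k) → x ≃ y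
  approx≡⇒≃ {x} {y} e ε 0<ε = 0 , λ k _ →
    subst (λ z → ∣ z ∣ < ε) (sym (trans (cong (_- approx y k) (e k)) (+-inverseʳ (approx y k)))) 0<ε

  approx-sumℝ : {A : Set} (xs : List A) (f : A → ℝ) (k : ℕ) → approx (sumℝ xs f) k ≡ sumℚ xs (λ a → approx (f a) k)
  approx-sumℝ []       f k = refl
  approx-sumℝ (x ∷ xs) f k = cong (approx (f x) k +_) (approx-sumℝ xs f k)

  -- `c` is the global sign. `y` enters through its partial sums because it is built with `-ℝ` in
  -- one identity and with `•` in the other two.
  scaled-sum≃ : ∀ {x y} {A : Set} (c : ℚ) (xs : List A) (f : A → ℝ) (t : ℕ⁺ → ℚ) →
    (∀ N → approx x N ≡ sum₁ N (λ n → c * t n)) →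
    (∀ N → sumℚ xs (λ a → approx (f a) N) ≡ sum₁ N t) →
    (∀ N → approx y N ≡ c * approx (sumℝ xs f) N) →
    x ≃ y
  scaled-sum≃ {x} {y} c xs f t ex ef ey = approx≡⇒≃ {x} {y} λ N → begin
    approx x N                            ≡⟨ ex N ⟩
    sum₁ N (λ n → c * t n)                ≡⟨ sum₁-* N c t ⟩
    c * sum₁ N t                          ≡⟨ cong (c *_) (ef N) ⟨
    c * sumℚ xs (λ a → approx (f a) N)    ≡⟨ cong (c *_) (approx-sumℝ xs f N) ⟨
    c * approx (sumℝ xs f) N              ≡⟨ ey N ⟨
    approx y N                            ∎

  -- The three families of Euler sums

  +^ˢ : ∀ n → Sign.+ ≡ Sign.+ ^ˢ n
  +^ˢ zero    = refl
  +^ˢ (suc n) = +^ˢ n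

  -- The summands are passed as a function f that is known through its partial
  -- sums only: comparing two expressions of type ℝ would, by the η-rule of the
  -- record, also compare their convergence proofs.

  S-rq̄≃ : ∀ m r q (f : List⁺ ℕ⁺ → ℝ) →
    (let open Expansion m r q Sign.+ Sign.- (λ _ → Sign.+) (λ _ → Sign.-) (λ t → +^ˢ (toℕ t)) (λ _ → refl)) →
    (∀ θ N → approx (f θ) N ≡ multinomial m θ * ζ-pair θ N) →
    S-rq̄ r m q ≃ -ℝ sumℝ (𝒞 m) f
  S-rq̄≃ m r q f f≡ = scaled-sum≃ {S-rq̄ r m q} {y = -ℝ sumℝ (𝒞 m) f} (- 1ℚ) (𝒞 m) f
    (λ n → term Sign.- q n * H₊ n)
    (λ N → sum₁-cong N λ n → trans
      (cong₂ (λ u v → u * v ^ toℕ m) (alt*recip≡ n q) (H≡ r (toℕ n)))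
      (*-assoc (- 1ℚ) (term Sign.- q n) (H₊ n)))
    (λ N → trans (sumℚ-cong (𝒞 m) (λ θ → f≡ θ N)) (expansion N))
    (λ N → solve 1 (λ x → :- x := con (- 1ℚ) :* x) refl (approx (sumℝ (𝒞 m) f) N))
    where
    open Expansion m r q Sign.+ Sign.- (λ _ → Sign.+) (λ _ → Sign.-) (λ t → +^ˢ (toℕ t)) (λ _ → refl)
    H₊ : ℕ⁺ → ℚ
    H₊ n = sum₁ (toℕ n) (term Sign.+ r) ^ toℕ m

  -- The only global sign comes from `H̄^`, as the outer sum does not alternate.
  S-r̄q≃ : ∀ m r q (q≥2 : 2 ℕ.≤ toℕ q) (f : List⁺ ℕ⁺ → ℝ) →
    (let open Expansion m r q Sign.- Sign.+ (λ t → Sign.- ^ˢ toℕ t) (λ t → Sign.- ^ˢ toℕ t) (λ _ → refl) (λ _ → refl)) →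
    (∀ θ N → approx (f θ) N ≡ multinomial m θ * ζ-pair θ N) →
    S-r̄q r m q q≥2 ≃ (- 1ℚ) ^ toℕ m • sumℝ (𝒞 m) f
  S-r̄q≃ m r q q≥2 f f≡ = scaled-sum≃ {S-r̄q r m q q≥2} {(- 1ℚ) ^ toℕ m • sumℝ (𝒞 m) f} ((- 1ℚ) ^ toℕ m) (𝒞 m) f
    (λ n → term Sign.+ q n * H₋ n)
    (λ N → sum₁-cong N λ n → trans
      (cong₂ _*_ (sym (trans (cong (_* recip n q) (1^ (toℕ n))) (*-identityˡ (recip n q)))) (H̄^ r (toℕ n) (toℕ m)))
      (solve 3 (λ t c h → t :* (c :* h) := c :* (t :* h)) refl (term Sign.+ q n) ((- 1ℚ) ^ toℕ m) (H₋ n)))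
    (λ N → trans (sumℚ-cong (𝒞 m) (λ θ → f≡ θ N)) (expansion N))
    (λ _ → refl)
    where
    open Expansion m r q Sign.- Sign.+ (λ t → Sign.- ^ˢ toℕ t) (λ t → Sign.- ^ˢ toℕ t) (λ _ → refl) (λ _ → refl)
    H₋ : ℕ⁺ → ℚ
    H₋ n = sum₁ (toℕ n) (term Sign.- r) ^ toℕ m

  -- The outer `alt` adds one factor -1 to the (-1)^m of `H̄^`, whence the exponent m + 1.
  S-r̄q̄≃ : ∀ m r q (f : List⁺ ℕ⁺ → ℝ) →
    (let open Expansion m r q Sign.- Sign.- (λ t → Sign.- ^ˢ toℕ t) (λ t → Sign.- ^ˢ (toℕ t ℕ.+ 1))
                        (λ _ → refl) (λ t → cong (Sign.- ^ˢ_) (ℕ.+-comm (toℕ t) 1))) →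
    (∀ θ N → approx (f θ) N ≡ multinomial m θ * ζ-pair θ N) →
    S-r̄q̄ r m q ≃ (- 1ℚ) ^ (toℕ m ℕ.+ 1) • sumℝ (𝒞 m) f
  S-r̄q̄≃ m r q f f≡ = scaled-sum≃ {S-r̄q̄ r m q} {(- 1ℚ) ^ (toℕ m ℕ.+ 1) • sumℝ (𝒞 m) f} ((- 1ℚ) ^ (toℕ m ℕ.+ 1)) (𝒞 m) f
    (λ n → term Sign.- q n * H₋ n)
    (λ N → sum₁-cong N λ n → begin
      alt n * recip n q * H̄ r (toℕ n) ^ toℕ m
        ≡⟨ cong₂ _*_ (alt*recip≡ n q) (H̄^ r (toℕ n) (toℕ m)) ⟩
      (- 1ℚ) * term Sign.- q n * ((- 1ℚ) ^ toℕ m * H₋ n)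
        ≡⟨ solve 3 (λ t c h → con (- 1ℚ) :* t :* (c :* h) := c :* con (- 1ℚ) :* (t :* h)) refl
             (term Sign.- q n) ((- 1ℚ) ^ toℕ m) (H₋ n) ⟩
      (- 1ℚ) ^ toℕ m * (- 1ℚ) * (term Sign.- q n * H₋ n)
        ≡⟨ cong (_* (term Sign.- q n * H₋ n)) (^-homo-* (- 1ℚ) (toℕ m) 1) ⟨
      (- 1ℚ) ^ (toℕ m ℕ.+ 1) * (term Sign.- q n * H₋ n) ∎)
    (λ N → trans (sumℚ-cong (𝒞 m) (λ θ → f≡ θ N)) (expansion N))
    (λ _ → refl)
    where
    open Expansion m r q Sign.- Sign.- (λ t → Sign.- ^ˢ toℕ t) (λ t → Sign.- ^ˢ (toℕ t ℕ.+ 1))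
                   (λ _ → refl) (λ t → cong (Sign.- ^ˢ_) (ℕ.+-comm (toℕ t) 1))
    H₋ : ℕ⁺ → ℚ
    H₋ n = sum₁ (toℕ n) (term Sign.- r) ^ toℕ m

open import Data.List.Base using (map)
open import Data.List.NonEmpty.Base using (_∷_; head; tail; toList)
open import Data.Nat.Base using (suc; _≤_; _+_)
open import Data.Product.Base using (_×_; _,_)
open import Data.Rational.Base using (1ℚ; -_; +-*-rawSemiring)
open import Data.Sign.Base using (Sign)
open import Algebra.Definitions.RawSemiring +-*-rawSemiring using (_^_)
open import Relation.Binary.PropositionalEquality using (refl)

theorem5p3 : (m r : ℕ⁺) →
  ((q : ℕ⁺) →
    S-rq̄ r m q ≃
      -ℝ (∑[ θ ∈ 𝒞 m ] multinomial m θ •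
            (ζ ((q , Sign.-) ∷ map (λ t → r *⁺ t , Sign.+) (toList θ)) bar-admissible
             +ℝ ζ ((q +⁺ r *⁺ head θ , Sign.-) ∷ map (λ t → r *⁺ t , Sign.+) (tail θ)) bar-admissible)))
  ×
  ((q : ℕ⁺) (q≥2 : 2 ≤ toℕ q) →
    S-r̄q r m q q≥2 ≃
      (- 1ℚ) ^ toℕ m • (∑[ θ ∈ 𝒞 m ] multinomial m θ •
            (ζ ((q , Sign.+) ∷ map (λ t → r *⁺ t , Sign.- ^ˢ toℕ t) (toList θ)) (≥2-admissible q≥2)
             +ℝ ζ ((q +⁺ r *⁺ head θ , Sign.- ^ˢ toℕ (head θ)) ∷ map (λ t → r *⁺ t , Sign.- ^ˢ toℕ t) (tail θ)) (+⁺-admissible q (r *⁺ head θ)))))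
  ×
  ((q : ℕ⁺) →
    S-r̄q̄ r m q ≃
      (- 1ℚ) ^ (toℕ m + 1) • (∑[ θ ∈ 𝒞 m ] multinomial m θ •
            (ζ ((q , Sign.-) ∷ map (λ t → r *⁺ t , Sign.- ^ˢ toℕ t) (toList θ)) bar-admissible
             +ℝ ζ ((q +⁺ r *⁺ head θ , Sign.- ^ˢ (toℕ (head θ) + 1)) ∷ map (λ t → r *⁺ t , Sign.- ^ˢ toℕ t) (tail θ)) (+⁺-admissible q (r *⁺ head θ)))))
-- The implicit arguments are those inferred in the statement: with them the
-- type of each component is syntactically the required one, and Agda does not
-- unfold the convergence proofs in order to compare the two.
theorem5p3 m r =
    (λ q → PartialSums.S-rq̄≃ m r q
      (λ θ → multinomial m θ •
        (ζ ((q , Sign.-) ∷ map (λ t → r *⁺ t , Sign.+) (toList θ)) (bar-admissible {q})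
         +ℝ ζ ((q +⁺ r *⁺ head θ , Sign.-) ∷ map (λ t → r *⁺ t , Sign.+) (tail θ))
              (bar-admissible {1+ (q .ℕ⁺.pred + suc ((r *⁺ head θ) .ℕ⁺.pred))})))
      -- The partial sums of a summand unfold to `multinomial m θ * ζ-pair θ N`.
      (λ _ _ → refl))
  , (λ q q≥2 → PartialSums.S-r̄q≃ m r q q≥2
      (λ θ → multinomial m θ •
        (ζ ((q , Sign.+) ∷ map (λ t → r *⁺ t , Sign.- ^ˢ toℕ t) (toList θ)) (≥2-admissible {q} {Sign.+} q≥2)
         +ℝ ζ ((q +⁺ r *⁺ head θ , Sign.- ^ˢ toℕ (head θ)) ∷ map (λ t → r *⁺ t , Sign.- ^ˢ toℕ t) (tail θ))
              (+⁺-admissible q (r *⁺ head θ) {Sign.- ^ˢ toℕ (head θ)})))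
      (λ _ _ → refl))
  , (λ q → PartialSums.S-r̄q̄≃ m r q
      (λ θ → multinomial m θ •
        (ζ ((q , Sign.-) ∷ map (λ t → r *⁺ t , Sign.- ^ˢ toℕ t) (toList θ)) (bar-admissible {q})
         +ℝ ζ ((q +⁺ r *⁺ head θ , Sign.- ^ˢ (toℕ (head θ) + 1)) ∷ map (λ t → r *⁺ t , Sign.- ^ˢ toℕ t) (tail θ))
              (+⁺-admissible q (r *⁺ head θ) {Sign.- ^ˢ (toℕ (head θ) + 1)})))
      (λ _ _ → refl))
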